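{- Let $t$ be an indeterminate and define polynomials $u_n\in\mathbb{Q}[t]$ (of degree $4n$) by $u_n=0$ for $n<0$, $u_0=1$, and for all $n\ge 0$ \begin{align*} &(n+1)^2u_{n+1} - 2^2\big(16(t^4-6t^3-4t^2+6t-1)(n^2+n)+4t^4-24t^3-12t^2+20t-3\big)u_n\\ &\quad - 2^{11}t(t-1)^3(t+1)\big(8(t^2+2t-1)n^2-2t^2-6t+3\big)u_{n-1}\\ &\quad + 2^{18}t^2(t-1)^6(t+1)^2(2n+1)(2n-3)u_{n-2}=0 . \end{align*} Then for every $n\ge0$, $u_n\in\mathbb{Z}[t]$ and $u_n$ is divisible by $\binom{2n}{n}$ in $\mathbb{Z}[t]$. -}

module Defs where

open import Data.Nat as ℕ using (ℕ; zero; suc)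
open import Data.Integer as ℤ using (ℤ; +_; -[1+_])
open import Data.Rational using (ℚ; _/_; 0ℚ; 1ℚ; _+_; _*_; _-_; -_)
open import Data.List using (List; map; foldr; upTo)
open import Data.Product using (_×_; _,_; proj₁)

-- Polynomials in one indeterminate t over ℚ, represented by their
-- coefficient function: p k is the coefficient of t^k.
Poly : Set
Poly = ℕ → ℚ

ι : ℤ → ℚ
ι z = z / 1

const : ℚ → Poly
const c zero    = c
const c (suc k) = 0ℚ

zeroP : Poly
zeroP _ = 0ℚ

oneP : Poly
oneP = const 1ℚ

tP : Poly
tP zero          = 0ℚ
tP (suc zero)    = 1ℚ
tP (suc (suc k)) = 0ℚ

_⊕_ : Poly → Poly → Poly
(p ⊕ q) k = p k + q k

_⊖_ : Poly → Poly → Poly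
(p ⊖ q) k = p k - q k

_⊗_ : Poly → Poly → Poly
(p ⊗ q) k = foldr _+_ 0ℚ (map (λ i → p i * q (k ℕ.∸ i)) (upTo (suc k)))

infixl 6 _⊕_ _⊖_
infixl 7 _⊗_

_·_ : ℚ → Poly → Poly
(c · p) k = c * p k
infixr 8 _·_

κ : ℤ → Poly
κ z = const (ι z)

_^P_ : Poly → ℕ → Poly
p ^P zero  = oneP
p ^P suc m = p ⊗ (p ^P m)

A : ℤ → Poly
A n = κ (+ 4) ⊗
      ( κ (+ 16 ℤ.* (n ℤ.* n ℤ.+ n)) ⊗
          (tP ^P 4 ⊖ κ (+ 6) ⊗ tP ^P 3 ⊖ κ (+ 4) ⊗ tP ^P 2 ⊕ κ (+ 6) ⊗ tP ⊖ oneP)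
      ⊕ (κ (+ 4) ⊗ tP ^P 4 ⊖ κ (+ 24) ⊗ tP ^P 3 ⊖ κ (+ 12) ⊗ tP ^P 2
          ⊕ κ (+ 20) ⊗ tP ⊖ κ (+ 3)))

B : ℤ → Poly
B n = κ (+ 2048) ⊗ tP ⊗ (tP ⊖ oneP) ^P 3 ⊗ (tP ⊕ oneP) ⊗
      ( κ (+ 8 ℤ.* (n ℤ.* n)) ⊗ (tP ^P 2 ⊕ κ (+ 2) ⊗ tP ⊖ oneP)
      ⊖ κ (+ 2) ⊗ tP ^P 2 ⊖ κ (+ 6) ⊗ tP ⊕ κ (+ 3))

Cₙ : ℤ → Poly
Cₙ n = κ (+ 262144) ⊗ tP ^P 2 ⊗ (tP ⊖ oneP) ^P 6 ⊗ (tP ⊕ oneP) ^P 2 ⊗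
      κ ((+ 2 ℤ.* n ℤ.+ + 1) ℤ.* (+ 2 ℤ.* n ℤ.- + 3))

-- One step of the recurrence: given u_n, u_{n-1}, u_{n-2}, produce u_{n+1} from
-- (n+1)^2 u_{n+1} - A n u_n - B n u_{n-1} + C n u_{n-2} = 0.
step : ℕ → Poly → Poly → Poly → Poly
step n a b c =
  ((+ 1) / (suc n ℕ.* suc n)) · (A (+ n) ⊗ a ⊕ B (+ n) ⊗ b ⊖ Cₙ (+ n) ⊗ c)

-- U n = (u_n , u_{n-1} , u_{n-2}), with u_m = 0 for m < 0 and u_0 = 1.
U : ℕ → Poly × Poly × Poly
U zero = oneP , zeroP , zeroP
U (suc n) with U n
... | a , b , c = step n a b c , a , b

u : ℕ → Poly
u n = proj₁ (U n)

{-# OPTIONS --safe #-}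
-- Write u_n = C(2n,n) v_n, r = (t-1)³(t+1), y = 16x and x = X². The generating
-- function of v_n is algebraic: it is the even part in X of G = H / √(BQ), where
--   B = 1 - r y,   Q = 1 + 4t(t²+t-1) y - 4t² r y²,   H⁴ = L √Q + 8 X S √B,
--   L = 1 - 2(t-1)³ y,   S = (2t-1) - 2t(t-1)³ y,   L² Q - 4 y S² B = 1.
-- All roots exist over ℤ[[t]][[X]], since 1 + 4cXf has a square root of the
-- form 1 + 2cXg. With θ = X d/dX and M = (2t-1) - 4t r y, the Pell equation gives
--   θH = 2XM G   and   BQ θG + ½ θ(BQ) G = 2XM H.
-- Eliminating H from the even coefficients yields a four-term recurrence for v_n,
-- which becomes the recurrence of u_n after multiplication by C(2n,n).
module Submission where

open import Algebra.Bundles using (CommutativeRing)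
import Algebra.Properties.Ring as RingProperties
import Algebra.Solver.Ring as RingSolver
open import Algebra.Solver.Ring.AlmostCommutativeRing
  using (_-Raw-AlmostCommutative⟶_; fromCommutativeRing)
open import Data.Integer as ℤ using (ℤ; +_)
import Data.Integer.Properties as ℤ
import Data.Integer.Solver as ℤ
open import Data.List using (foldr; applyUpTo)
open import Data.List.Properties using (map-upTo)
open import Data.Maybe using (Maybe; just; nothing)
open import Data.Nat as ℕ using (ℕ; zero; suc)
open import Data.Nat.Combinatorics using (nCk≡n!/k![n-k]!; k![n∸k]!∣n!)
import Data.Nat.DivMod as ℕ
import Data.Nat.Properties as ℕ
import Data.Nat.Solver as ℕ
open import Data.Product using (∃-syntax; _×_; _,_; proj₁; proj₂)
open import Data.Rational as ℚ using (0ℚ; toℚᵘ)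
import Data.Rational.Properties as ℚ
import Data.Rational.Unnormalised as ℚᵘ
import Data.Rational.Unnormalised.Properties as ℚᵘ
open import Level using (0ℓ)
open import Relation.Binary.PropositionalEquality as ≡ using (_≡_)
open import Relation.Nullary using (yes; no)

-- The recurrence divides by (n+1)² at every step, so by itself it does not show integrality. Here
-- integrality comes instead from constructing roots over the integers. The obstacle is the prime 2:
-- each root constructed below needs a spare factor 4 and leaves only a factor 2 behind, and the
-- powers of 2 in L, S, B and Q are what pays for all the roots. The variable X is adjoined because
-- the second term of H⁴ is a square root of 4yS²B, which contains √x. The pair (H, G) replaces a
-- second-order equation for G by a first-order system with polynomial coefficients. Since 2 and 2n
-- - 1 are not invertible, equations are multiplied out and such factors cancelled at the end. The
-- claim concerns each coefficient in t separately, so v_n may be built as a power series in t.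

IntegersTo : CommutativeRing 0ℓ 0ℓ → Set
IntegersTo R = ℤ.+-*-rawRing -Raw-AlmostCommutative⟶ fromCommutativeRing R

module IntegerSolver (R : CommutativeRing 0ℓ 0ℓ) (φ : IntegersTo R) where
  open CommutativeRing R using (_≈_; reflexive)
  open _-Raw-AlmostCommutative⟶_ φ using (⟦_⟧)

  private
    equal? : ∀ i j → Maybe (⟦ i ⟧ ≈ ⟦ j ⟧)
    equal? i j with i ℤ.≟ j
    ... | yes i≡j = just (reflexive (≡.cong ⟦_⟧ i≡j))
    ... | no  _   = nothing

  open RingSolver ℤ.+-*-rawRing (fromCommutativeRing R) φ equal? public
    using (Polynomial; solve; con; _:=_; _:+_; _:*_; _:-_; :-_)

-- Substitute for division: derivatives of roots are found from their squares, which costs a factor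
-- 2; a constant is recognised from k c_k = 0; and the final recurrence appears multiplied by 4(2n -
-- 1).
record TorsionFree (R : CommutativeRing 0ℓ 0ℓ) (φ : IntegersTo R) : Set where
  open CommutativeRing R using (Carrier; _≈_; _*_)
  open _-Raw-AlmostCommutative⟶_ φ using (⟦_⟧)
  field
    cancel : ∀ i .{{_ : ℤ.NonZero i}} (x y : Carrier) → ⟦ i ⟧ * x ≈ ⟦ i ⟧ * y → x ≈ y

-- Formal power series over a commutative ring, with the derivation X d/dX.

module PowerSeries (R : CommutativeRing 0ℓ 0ℓ) (φ : IntegersTo R) where
  open CommutativeRing R
  open RingProperties ring using (-0#≈0#)
  open _-Raw-AlmostCommutative⟶_ φ
    using (⟦_⟧; +-homo; *-homo; -‿homo; 0-homo; 1-homo)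
  open IntegerSolver R φ
  open import Relation.Binary.Reasoning.Setoid setoid

  Series : Set
  Series = ℕ → Carrier

  infix  4 _≋_
  infixl 6 _⊞_
  infixl 7 _⊠_

  _≋_ : Series → Series → Set
  f ≋ g = ∀ k → f k ≈ g k

  _⊞_ : Series → Series → Series
  (f ⊞ g) k = f k + g k

  neg : Series → Series
  neg f k = - f k

  C : Carrier → Series
  C c zero    = c
  C c (suc _) = 0#

  X : Series
  X zero          = 0#
  X (suc zero)    = 1#
  X (suc (suc _)) = 0#

  tail : Series → Series
  tail f k = f (suc k)

  -- Reads off fg = f₀ g + X (tail f) g coefficient by coefficient. This replaces finite sums by
  -- structural recursion.
  _⊠_ : Series → Series → Series
  (f ⊠ g) zero    = f 0 * g 0
  (f ⊠ g) (suc k) = f 0 * g (suc k) + (tail f ⊠ g) k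

  ⊠-cong : ∀ {f f′ g g′} → f ≋ f′ → g ≋ g′ → f ⊠ g ≋ f′ ⊠ g′
  ⊠-cong p q zero    = *-cong (p 0) (q 0)
  ⊠-cong p q (suc k) =
    +-cong (*-cong (p 0) (q (suc k))) (⊠-cong (λ i → p (suc i)) q k)

  ⊠-zeroˡ : ∀ f g → (∀ k → f k ≈ 0#) → ∀ k → (f ⊠ g) k ≈ 0#
  ⊠-zeroˡ f g f≈0 zero    = trans (*-congʳ (f≈0 0)) (zeroˡ _)
  ⊠-zeroˡ f g f≈0 (suc k) = begin
    f 0 * g (suc k) + (tail f ⊠ g) k
      ≈⟨ +-cong (*-congʳ (f≈0 0)) (⊠-zeroˡ (tail f) g (λ i → f≈0 (suc i)) k) ⟩
    0# * g (suc k) + 0#  ≈⟨ +-identityʳ _ ⟩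
    0# * g (suc k)       ≈⟨ zeroˡ _ ⟩
    0#                   ∎

  C-⊠ : ∀ c g k → (C c ⊠ g) k ≈ c * g k
  C-⊠ c g zero    = refl
  C-⊠ c g (suc k) =
    trans (+-congˡ (⊠-zeroˡ (tail (C c)) g (λ _ → refl) k)) (+-identityʳ _)

  X-⊠-zero : ∀ g → (X ⊠ g) 0 ≈ 0#
  X-⊠-zero g = zeroˡ _

  X-⊠-suc : ∀ g k → (X ⊠ g) (suc k) ≈ g k
  X-⊠-suc g k = begin
    0# * g (suc k) + (tail X ⊠ g) k
      ≈⟨ +-cong (zeroˡ _) (⊠-cong tailX (λ _ → refl) k) ⟩
    0# + (C 1# ⊠ g) k  ≈⟨ +-identityˡ _ ⟩
    (C 1# ⊠ g) k       ≈⟨ C-⊠ 1# g k ⟩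
    1# * g k           ≈⟨ *-identityˡ _ ⟩
    g k                ∎
    where
    tailX : tail X ≋ C 1#
    tailX zero    = refl
    tailX (suc _) = refl

  ⊠-distribʳ : ∀ h f g → (f ⊞ g) ⊠ h ≋ (f ⊠ h) ⊞ (g ⊠ h)
  ⊠-distribʳ h f g zero    = distribʳ _ _ _
  ⊠-distribʳ h f g (suc k) = trans
    (+-congˡ (⊠-distribʳ h (tail f) (tail g) k))
    (solve 5 (λ a b c d e → (a :+ b) :* c :+ (d :+ e)
                         := a :* c :+ d :+ (b :* c :+ e)) refl _ _ _ _ _)

  -- The mirror image of the defining recursion, peeling off g₀ instead of f₀; commutativity follows
  -- by comparing the two.
  ⊠-suc : ∀ f g k → (f ⊠ g) (suc k) ≈ (f ⊠ tail g) k + f (suc k) * g 0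
  ⊠-suc f g zero    = refl
  ⊠-suc f g (suc k) = trans (+-congˡ (⊠-suc (tail f) g k)) (sym (+-assoc _ _ _))

  ⊠-comm : ∀ f g → f ⊠ g ≋ g ⊠ f
  ⊠-comm f g zero    = *-comm _ _
  ⊠-comm f g (suc k) = begin
    f 0 * g (suc k) + (tail f ⊠ g) k  ≈⟨ +-cong (*-comm _ _) (⊠-comm (tail f) g k) ⟩
    g (suc k) * f 0 + (g ⊠ tail f) k  ≈⟨ +-comm _ _ ⟩
    (g ⊠ tail f) k + g (suc k) * f 0  ≈⟨ ⊠-suc g f k ⟨
    (g ⊠ f) (suc k)                   ∎

  scale-⊠ : ∀ c f g k → ((λ i → c * f i) ⊠ g) k ≈ c * (f ⊠ g) k
  scale-⊠ c f g zero    = *-assoc _ _ _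
  scale-⊠ c f g (suc k) = trans
    (+-congˡ (scale-⊠ c (tail f) g k))
    (solve 4 (λ a b d e → a :* b :* d :+ a :* e := a :* (b :* d :+ e)) refl _ _ _ _)

  ⊠-assoc : ∀ f g h → (f ⊠ g) ⊠ h ≋ f ⊠ (g ⊠ h)
  ⊠-assoc f g h zero    = *-assoc _ _ _
  ⊠-assoc f g h (suc k) = begin
    f 0 * g 0 * h (suc k) + (tail (f ⊠ g) ⊠ h) k
      ≈⟨ +-congˡ (⊠-distribʳ h (λ i → f 0 * g (suc i)) (tail f ⊠ g) k) ⟩
    f 0 * g 0 * h (suc k) + (((λ i → f 0 * g (suc i)) ⊠ h) k + ((tail f ⊠ g) ⊠ h) k)
      ≈⟨ +-congˡ (+-cong (scale-⊠ (f 0) (tail g) h k) (⊠-assoc (tail f) g h k)) ⟩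
    f 0 * g 0 * h (suc k) + (f 0 * (tail g ⊠ h) k + (tail f ⊠ (g ⊠ h)) k)
      ≈⟨ solve 5 (λ a b c d e → a :* b :* c :+ (a :* d :+ e)
                             := a :* (b :* c :+ d) :+ e) refl _ _ _ _ _ ⟩
    f 0 * (g ⊠ h) (suc k) + (tail f ⊠ (g ⊠ h)) k  ∎

  seriesRing : CommutativeRing 0ℓ 0ℓ
  seriesRing = record
    { Carrier = Series ; _≈_ = _≋_ ; _+_ = _⊞_ ; _*_ = _⊠_ ; -_ = neg
    ; 0# = λ _ → 0# ; 1# = C 1#
    ; isCommutativeRing = record
      { isRing = record
        { +-isAbelianGroup = record
          { isGroup = record
            { isMonoid = record
              { isSemigroup = record
                { isMagma = record
                  { isEquivalence = record
                    { refl  = λ _ → refl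
                    ; sym   = λ p k → sym (p k)
                    ; trans = λ p q k → trans (p k) (q k) }
                  ; ∙-cong = λ p q k → +-cong (p k) (q k) }
                ; assoc = λ f g h k → +-assoc _ _ _ }
              ; identity = (λ f k → +-identityˡ _) , (λ f k → +-identityʳ _) }
            ; inverse = (λ f k → -‿inverseˡ _) , (λ f k → -‿inverseʳ _)
            ; ⁻¹-cong = λ p k → -‿cong (p k) }
          ; comm = λ f g k → +-comm _ _ }
        ; *-cong = ⊠-cong
        ; *-assoc = ⊠-assoc
        ; *-identity = 1-⊠ , (λ f k → trans (⊠-comm f (C 1#) k) (1-⊠ f k))
        ; distrib = ⊠-distribˡ , ⊠-distribʳ }
      ; *-comm = ⊠-comm } }
    where
    1-⊠ : ∀ f → C 1# ⊠ f ≋ f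
    1-⊠ f k = trans (C-⊠ 1# f k) (*-identityˡ _)

    ⊠-distribˡ : ∀ f g h → f ⊠ (g ⊞ h) ≋ (f ⊠ g) ⊞ (f ⊠ h)
    ⊠-distribˡ f g h k = begin
      (f ⊠ (g ⊞ h)) k          ≈⟨ ⊠-comm f (g ⊞ h) k ⟩
      ((g ⊞ h) ⊠ f) k          ≈⟨ ⊠-distribʳ f g h k ⟩
      (g ⊠ f) k + (h ⊠ f) k    ≈⟨ +-cong (⊠-comm g f k) (⊠-comm h f k) ⟩
      (f ⊠ g) k + (f ⊠ h) k    ∎

  C-* : ∀ c d → C (c * d) ≋ C c ⊠ C d
  C-* c d zero    = refl
  C-* c d (suc k) = sym (trans (C-⊠ c (C d) (suc k)) (zeroʳ c))

  constants : IntegersTo seriesRing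
  constants = record
    { ⟦_⟧    = λ i → C ⟦ i ⟧
    ; +-homo = λ { i j zero → +-homo i j ; i j (suc _) → sym (+-identityˡ 0#) }
    ; *-homo = λ { i j zero → *-homo i j ; i j (suc k) → C-* ⟦ i ⟧ ⟦ j ⟧ (suc k) }
    ; -‿homo = λ { i zero → -‿homo i ; i (suc _) → sym -0#≈0# }
    ; 0-homo = λ { zero → 0-homo ; (suc _) → refl }
    ; 1-homo = λ { zero → 1-homo ; (suc _) → refl } }

  torsionFree : TorsionFree R φ → TorsionFree seriesRing constants
  torsionFree tf = record
    { cancel = λ i f g p k → TorsionFree.cancel tf i (f k) (g k)
        (trans (sym (C-⊠ ⟦ i ⟧ f k)) (trans (p k) (C-⊠ ⟦ i ⟧ g k))) }

  θ : Series → Series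
  θ f k = ⟦ + k ⟧ * f k

  θ-⊞ : ∀ f g → θ (f ⊞ g) ≋ θ f ⊞ θ g
  θ-⊞ f g k = distribˡ _ _ _

  θ-C : ∀ c k → θ (C c) k ≈ 0#
  θ-C c zero    = trans (*-congʳ 0-homo) (zeroˡ c)
  θ-C c (suc k) = zeroʳ _

  θ-X : θ X ≋ X
  θ-X zero          = zeroʳ _
  θ-X (suc zero)    = trans (*-congʳ 1-homo) (*-identityˡ 1#)
  θ-X (suc (suc k)) = zeroʳ _

  private
    suc-homo : ∀ k x → ⟦ + suc k ⟧ * x ≈ x + ⟦ + k ⟧ * x
    suc-homo k x = trans (*-congʳ (trans (+-homo (+ 1) (+ k)) (+-congʳ 1-homo)))
      (trans (distribʳ x 1# ⟦ + k ⟧) (+-congʳ (*-identityˡ x)))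

  θ-⊠ : ∀ f g → θ (f ⊠ g) ≋ θ f ⊠ g ⊞ f ⊠ θ g
  θ-⊠ f g zero    =
    solve 2 (λ a b → con (+ 0) :* (a :* b)
                  := con (+ 0) :* a :* b :+ a :* (con (+ 0) :* b)) refl (f 0) (g 0)
  θ-⊠ f g (suc k) = begin
    ⟦ + suc k ⟧ * (f 0 * g (suc k) + m)
      ≈⟨ distribˡ _ _ _ ⟩
    ⟦ + suc k ⟧ * (f 0 * g (suc k)) + ⟦ + suc k ⟧ * m
      ≈⟨ +-congˡ (trans (suc-homo k m) (+-congˡ (θ-⊠ (tail f) g k))) ⟩
    ⟦ + suc k ⟧ * (f 0 * g (suc k)) + (m + ((θ (tail f) ⊠ g) k + (tail f ⊠ θ g) k))
      ≈⟨ solve 6 (λ n a b c d e → n :* (a :* b) :+ (c :+ (d :+ e))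
           := con (+ 0) :* a :* b :+ (c :+ d) :+ (a :* (n :* b) :+ e)) refl _ _ _ _ _ _ ⟩
    ⟦ + 0 ⟧ * f 0 * g (suc k) + (m + (θ (tail f) ⊠ g) k)
      + (f 0 * (⟦ + suc k ⟧ * g (suc k)) + (tail f ⊠ θ g) k)
      -- As `tail` lowers the degree by one, tail (θ f) = tail f + θ (tail f); this absorbs the
      -- extra copy of `m`.
      ≈⟨ +-congʳ (+-congˡ (trans (sym (⊠-distribʳ g (tail f) (θ (tail f)) k))
           (⊠-cong (λ i → sym (suc-homo i (f (suc i)))) (λ _ → refl) k))) ⟩
    ⟦ + 0 ⟧ * f 0 * g (suc k) + (tail (θ f) ⊠ g) k
      + (f 0 * (⟦ + suc k ⟧ * g (suc k)) + (tail f ⊠ θ g) k)  ∎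
    where m = (tail f ⊠ g) k

  -- Congruence modulo powers of X, and fixed points.

  _≈[_]_ : Series → ℕ → Series → Set
  f ≈[ n ] g = ∀ k → k ℕ.< n → f k ≈ g k

  -- The contraction principle for the X-adic metric: each application of F fixes one more
  -- coefficient.
  module FixedPoint (F : Series → Series)
    (contract : ∀ n {f g} → f ≈[ n ] g → F f ≈[ suc n ] F g) where

    private
      iterate : ℕ → Series
      iterate zero    = λ _ → 0#
      iterate (suc n) = F (iterate n)

      iterate-step : ∀ n → iterate n ≈[ n ] iterate (suc n)
      iterate-step zero    = λ _ ()
      iterate-step (suc n) = contract n (iterate-step n)

      iterate-stable : ∀ {m n} → m ℕ.≤′ n → iterate m ≈[ m ] iterate n
      iterate-stable ℕ.≤′-refl       k k<m = refl
      iterate-stable (ℕ.≤′-step m≤n) k k<m = trans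
        (iterate-stable m≤n k k<m)
        (iterate-step _ k (ℕ.≤-trans k<m (ℕ.≤′⇒≤ m≤n)))

    fix : Series
    -- From iterate k+1 on, the coefficient at k no longer changes, so the diagonal is the limit.
    fix k = iterate (suc k) k

    fix-unfold : fix ≋ F fix
    fix-unfold k = contract k {iterate k} {fix}
      (λ j j<k → sym (iterate-stable (ℕ.≤⇒≤′ j<k) j ℕ.≤-refl)) k ℕ.≤-refl

  -- The factor X makes the right-hand side a contraction. The case b = 0 serves square roots, the
  -- case c = 0 inverses.
  quadratic : ∀ a b c → ∃[ f ] f ≋ a ⊞ X ⊠ ((b ⊞ c ⊠ f) ⊠ f)
  quadratic a b c = fix , fix-unfold
    where
    ⊠-local : ∀ n {f f′ g g′} → f ≈[ n ] f′ → g ≈[ n ] g′ → (f ⊠ g) ≈[ n ] (f′ ⊠ g′)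
    ⊠-local n p q zero    k<n = *-cong (p 0 k<n) (q 0 k<n)
    ⊠-local (suc n) p q (suc k) k<n = +-cong
      (*-cong (p 0 (ℕ.s≤s ℕ.z≤n)) (q (suc k) k<n))
      (⊠-local n (λ i i<n → p (suc i) (ℕ.s≤s i<n))
                 (λ i i<n → q i (ℕ.m≤n⇒m≤1+n i<n)) k (ℕ.s≤s⁻¹ k<n))

    contract : ∀ n {f g} → f ≈[ n ] g →
      (a ⊞ X ⊠ ((b ⊞ c ⊠ f) ⊠ f)) ≈[ suc n ] (a ⊞ X ⊠ ((b ⊞ c ⊠ g) ⊠ g))
    contract n {f} {g} p zero _ = +-congˡ (trans (X-⊠-zero ((b ⊞ c ⊠ f) ⊠ f))
      (sym (X-⊠-zero ((b ⊞ c ⊠ g) ⊠ g))))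
    contract n p (suc k) k<n =
      +-congˡ (trans (X-⊠-suc _ k) (trans
      (⊠-local n (λ i i<n → +-congˡ (⊠-local n (λ _ _ → refl) p i i<n)) p k (ℕ.s≤s⁻¹ k<n))
      (sym (X-⊠-suc _ k))))

    open FixedPoint (λ f → a ⊞ X ⊠ ((b ⊞ c ⊠ f) ⊠ f)) contract

-- Roots, inverses and derivatives in a ring with an X-adic derivation.

-- The factor 16 of y = 16x is absorbed in the constants.
module Parameters {A : Set} (add mul : A → A → A) (⟦_⟧ : ℤ → A) (t : A) where
  private
    infixl 6 _+_
    infixl 7 _*_

    _+_ _*_ : A → A → A
    _+_ = add
    _*_ = mul

  -1# e³ r m₀ m₁ l₁ s₁ b₁ q₁ q₂ : A
  -1# = ⟦ ℤ.- + 1 ⟧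
  e³  = (t + -1#) * (t + -1#) * (t + -1#)
  r   = e³ * (t + ⟦ + 1 ⟧)
  m₀  = ⟦ + 2 ⟧ * t + -1#
  m₁  = ⟦ ℤ.- + 64 ⟧ * (t * r)
  l₁  = ⟦ ℤ.- + 32 ⟧ * e³
  s₁  = ⟦ ℤ.- + 32 ⟧ * (t * e³)
  b₁  = ⟦ ℤ.- + 16 ⟧ * r
  q₁  = ⟦ + 64 ⟧ * (t * (t * t + t + -1#))
  q₂  = ⟦ ℤ.- + 1024 ⟧ * (t * t * r)

  L S M B Q θB/2 θQ/2 : A → A
  L x = ⟦ + 1 ⟧ + l₁ * x
  S x = m₀ + s₁ * x
  M x = m₀ + m₁ * x
  B x = ⟦ + 1 ⟧ + b₁ * x
  Q x = ⟦ + 1 ⟧ + q₁ * x + q₂ * (x * x)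
  θB/2 x = b₁ * x
  θQ/2 x = q₁ * x + ⟦ + 2 ⟧ * q₂ * (x * x)

-- quadratic is the only consequence of X-adic completeness that the roots need.
record XAdicDerivation (R : CommutativeRing 0ℓ 0ℓ) (φ : IntegersTo R) : Set where
  open CommutativeRing R
  open _-Raw-AlmostCommutative⟶_ φ using (⟦_⟧)
  field
    θ         : Carrier → Carrier
    θ-cong    : ∀ {f g} → f ≈ g → θ f ≈ θ g
    θ-+       : ∀ f g → θ (f + g) ≈ θ f + θ g
    θ-*       : ∀ f g → θ (f * g) ≈ θ f * g + f * θ g
    θ-⟦⟧      : ∀ i → θ ⟦ i ⟧ ≈ 0#
    X t       : Carrier
    θ-X       : θ X ≈ X
    θ-t       : θ t ≈ 0#
    quadratic : ∀ a b c → ∃[ f ] f ≈ a + X * ((b + c * f) * f)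

module Differential (R : CommutativeRing 0ℓ 0ℓ) (φ : IntegersTo R)
                    (tf : TorsionFree R φ) (δ : XAdicDerivation R φ) where
  open CommutativeRing R
  open _-Raw-AlmostCommutative⟶_ φ using (⟦_⟧)
  open XAdicDerivation δ
  open TorsionFree tf using (cancel)
  open IntegerSolver R φ
  open Parameters _+_ _*_ ⟦_⟧ t
  module Pₛ {n} = Parameters (_:+_ {n}) _:*_ con
  open import Relation.Binary.Reasoning.Setoid setoid

  -- Constants are the kernel of θ because the ring is abstract here; for power series over a
  -- torsion-free ring these are the constant series, see `constant-⊠`.
  Constant : Carrier → Set
  Constant c = θ c ≈ 0#

  infixl 6 _+ᶜ_
  infixl 7 _*ᶜ_

  _+ᶜ_ : ∀ {c d} → Constant c → Constant d → Constant (c + d)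
  p +ᶜ q = trans (θ-+ _ _) (trans (+-cong p q) (+-identityˡ 0#))

  _*ᶜ_ : ∀ {c d} → Constant c → Constant d → Constant (c * d)
  p *ᶜ q = trans (θ-* _ _) (trans (+-cong (trans (*-congʳ p) (zeroˡ _))
    (trans (*-congˡ q) (zeroʳ _))) (+-identityˡ 0#))

  e³ᶜ : Constant e³
  e³ᶜ = e *ᶜ e *ᶜ e where e = θ-t +ᶜ θ-⟦⟧ _

  rᶜ : Constant r
  rᶜ = e³ᶜ *ᶜ (θ-t +ᶜ θ-⟦⟧ _)

  m₀ᶜ : Constant m₀
  m₀ᶜ = θ-⟦⟧ _ *ᶜ θ-t +ᶜ θ-⟦⟧ _

  m₁ᶜ : Constant m₁
  m₁ᶜ = θ-⟦⟧ _ *ᶜ (θ-t *ᶜ rᶜ)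

  l₁ᶜ : Constant l₁
  l₁ᶜ = θ-⟦⟧ _ *ᶜ e³ᶜ

  s₁ᶜ : Constant s₁
  s₁ᶜ = θ-⟦⟧ _ *ᶜ (θ-t *ᶜ e³ᶜ)

  b₁ᶜ : Constant b₁
  b₁ᶜ = θ-⟦⟧ _ *ᶜ rᶜ

  q₁ᶜ : Constant q₁
  q₁ᶜ = θ-⟦⟧ _ *ᶜ (θ-t *ᶜ (θ-t *ᶜ θ-t +ᶜ θ-t +ᶜ θ-⟦⟧ _))

  q₂ᶜ : Constant q₂
  q₂ᶜ = θ-⟦⟧ _ *ᶜ (θ-t *ᶜ θ-t *ᶜ rᶜ)

  x : Carrier
  x = X * X

  θ-x : θ x ≈ ⟦ + 2 ⟧ * x
  θ-x = trans (θ-* X X) (trans (+-cong (*-congʳ θ-X) (*-congˡ θ-X))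
    (solve 1 (λ X → X :* X :+ X :* X := con (+ 2) :* (X :* X)) refl X))

  θ-scale : ∀ {c} → Constant c → ∀ f → θ (c * f) ≈ c * θ f
  θ-scale {c} p f =
    trans (θ-* c f) (trans (+-congʳ (trans (*-congʳ p) (zeroˡ f))) (+-identityˡ _))

  θ-linear : ∀ {c d} → Constant c → Constant d → θ (c + d * x) ≈ ⟦ + 2 ⟧ * (d * x)
  θ-linear {c} {d} p q = begin
    θ (c + d * x)          ≈⟨ θ-+ _ _ ⟩
    θ c + θ (d * x)        ≈⟨ +-cong p (trans (θ-scale q x) (*-congˡ θ-x)) ⟩
    0# + d * (⟦ + 2 ⟧ * x) ≈⟨ +-identityˡ _ ⟩
    d * (⟦ + 2 ⟧ * x)
      ≈⟨ solve 2 (λ d x → d :* (con (+ 2) :* x) := con (+ 2) :* (d :* x)) refl d x ⟩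
    ⟦ + 2 ⟧ * (d * x)      ∎

  θ-Q : θ (Q x) ≈ ⟦ + 2 ⟧ * θQ/2 x
  θ-Q = begin
    θ (Q x)  ≈⟨ θ-+ _ _ ⟩
    θ (⟦ + 1 ⟧ + q₁ * x) + θ (q₂ * (x * x))
      ≈⟨ +-cong (θ-linear (θ-⟦⟧ _) q₁ᶜ) (trans (θ-scale q₂ᶜ _)
           (*-congˡ (trans (θ-* x x) (+-cong (*-congʳ θ-x) (*-congˡ θ-x))))) ⟩
    ⟦ + 2 ⟧ * (q₁ * x) + q₂ * (⟦ + 2 ⟧ * x * x + x * (⟦ + 2 ⟧ * x))
      ≈⟨ solve 3 (λ q₁ q₂ x → con (+ 2) :* (q₁ :* x)
             :+ q₂ :* (con (+ 2) :* x :* x :+ x :* (con (+ 2) :* x))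
           := con (+ 2) :* (q₁ :* x :+ con (+ 2) :* q₂ :* (x :* x))) refl q₁ q₂ x ⟩
    ⟦ + 2 ⟧ * θQ/2 x  ∎

  sqrt : ∀ c f → ∃[ g ] (⟦ + 1 ⟧ + ⟦ + 2 ⟧ * ⟦ c ⟧ * (X * g)) * (⟦ + 1 ⟧ + ⟦ + 2 ⟧ * ⟦ c ⟧ * (X * g))
                    ≈ ⟦ + 1 ⟧ + ⟦ + 4 ⟧ * ⟦ c ⟧ * (X * f)
  -- Since (1 + 2cXg)² = 1 + 4cX(g + cXg²), it is enough to solve g = f - cXg².
  sqrt c f with quadratic f 0# (- ⟦ c ⟧)
  ... | g , p = g , (begin
    (⟦ + 1 ⟧ + ⟦ + 2 ⟧ * ⟦ c ⟧ * (X * g)) * (⟦ + 1 ⟧ + ⟦ + 2 ⟧ * ⟦ c ⟧ * (X * g))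
      ≈⟨ solve 3 (λ c X g → (con (+ 1) :+ con (+ 2) :* c :* (X :* g))
             :* (con (+ 1) :+ con (+ 2) :* c :* (X :* g))
           := con (+ 1) :+ con (+ 4) :* c :* (X :* (g :+ X :* (c :* g :* g)))) refl ⟦ c ⟧ X g ⟩
    ⟦ + 1 ⟧ + ⟦ + 4 ⟧ * ⟦ c ⟧ * (X * (g + X * (⟦ c ⟧ * g * g)))
      ≈⟨ +-congˡ (*-congˡ (*-congˡ (+-congʳ p))) ⟩
    ⟦ + 1 ⟧ + ⟦ + 4 ⟧ * ⟦ c ⟧ * (X * (f + X * ((0# + (- ⟦ c ⟧) * g) * g) + X * (⟦ c ⟧ * g * g)))
      ≈⟨ +-congˡ (*-congˡ (*-congˡ (+-congʳ (+-congˡ (*-congˡ (*-congʳ (+-identityˡ _))))))) ⟩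
    ⟦ + 1 ⟧ + ⟦ + 4 ⟧ * ⟦ c ⟧ * (X * (f + X * ((- ⟦ c ⟧) * g * g) + X * (⟦ c ⟧ * g * g)))
      ≈⟨ solve 4 (λ c X f g → con (+ 1) :+ con (+ 4) :* c :*
             (X :* (f :+ X :* ((:- c) :* g :* g) :+ X :* (c :* g :* g)))
           := con (+ 1) :+ con (+ 4) :* c :* (X :* f)) refl ⟦ c ⟧ X f g ⟩
    ⟦ + 1 ⟧ + ⟦ + 4 ⟧ * ⟦ c ⟧ * (X * f)  ∎)

  inverse : ∀ f → ∃[ g ] (⟦ + 1 ⟧ + X * f) * (⟦ + 1 ⟧ + X * g) ≈ ⟦ + 1 ⟧
  -- The product is 1 + X(f + g + Xfg), so g = -f - Xfg is the equation to solve.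
  inverse f with quadratic (- f) (- f) 0#
  ... | g , p = g , (begin
    (⟦ + 1 ⟧ + X * f) * (⟦ + 1 ⟧ + X * g)
      ≈⟨ solve 3 (λ X f g → (con (+ 1) :+ X :* f) :* (con (+ 1) :+ X :* g)
           := con (+ 1) :+ X :* (f :+ X :* (f :* g) :+ g)) refl X f g ⟩
    ⟦ + 1 ⟧ + X * (f + X * (f * g) + g)
      ≈⟨ +-congˡ (*-congˡ (+-congˡ (trans p (+-congˡ (*-congˡ (*-congʳ
           (trans (+-congˡ (zeroˡ g)) (+-identityʳ (- f))))))))) ⟩
    ⟦ + 1 ⟧ + X * (f + X * (f * g) + (- f + X * ((- f) * g)))
      ≈⟨ solve 3 (λ X f g → con (+ 1) :+ X :* (f :+ X :* (f :* g) :+ (:- f :+ X :* ((:- f) :* g)))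
           := con (+ 1)) refl X f g ⟩
    ⟦ + 1 ⟧  ∎)

  half-derivative : ∀ {f g g′} → f * f ≈ g → θ g ≈ ⟦ + 2 ⟧ * g′ → f * θ f ≈ g′
  half-derivative {f} {g} {g′} p q = cancel (+ 2) _ _ (begin
    ⟦ + 2 ⟧ * (f * θ f)
      ≈⟨ solve 2 (λ f f′ → con (+ 2) :* (f :* f′) := f′ :* f :+ f :* f′) refl f (θ f) ⟩
    θ f * f + f * θ f  ≈⟨ θ-* f f ⟨
    θ (f * f)          ≈⟨ θ-cong p ⟩
    θ g                ≈⟨ q ⟩
    ⟦ + 2 ⟧ * g′       ∎)

  -- A square root halves the logarithmic derivative: θg/g = 2c/d becomes θf/f = c/d. The inverse of
  -- f removes the extra factor in θ(f²) = 2fθf.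
  sqrt-solution : ∀ {d c f g f⁻¹} → f * f ≈ g → f * f⁻¹ ≈ ⟦ + 1 ⟧ →
    d * θ g ≈ ⟦ + 2 ⟧ * (c * g) → d * θ f ≈ c * f
  sqrt-solution {d} {c} {f} {g} {f⁻¹} p unit q = cancel (+ 2) _ _ (begin
    ⟦ + 2 ⟧ * (d * θ f)
      ≈⟨ *-congˡ (unit-* (d * θ f)) ⟨
    ⟦ + 2 ⟧ * (f * f⁻¹ * (d * θ f))
      ≈⟨ solve 4 (λ d f i f′ → con (+ 2) :* (f :* i :* (d :* f′))
           := i :* (d :* (f′ :* f :+ f :* f′))) refl d f f⁻¹ (θ f) ⟩
    f⁻¹ * (d * (θ f * f + f * θ f))
      ≈⟨ *-congˡ (*-congˡ (trans (sym (θ-* f f)) (θ-cong p))) ⟩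
    f⁻¹ * (d * θ g)               ≈⟨ *-congˡ q ⟩
    f⁻¹ * (⟦ + 2 ⟧ * (c * g))     ≈⟨ *-congˡ (*-congˡ (*-congˡ p)) ⟨
    f⁻¹ * (⟦ + 2 ⟧ * (c * (f * f)))
      ≈⟨ solve 3 (λ c f i → i :* (con (+ 2) :* (c :* (f :* f)))
           := con (+ 2) :* (f :* i :* (c :* f))) refl c f f⁻¹ ⟩
    ⟦ + 2 ⟧ * (f * f⁻¹ * (c * f))  ≈⟨ *-congˡ (unit-* (c * f)) ⟩
    ⟦ + 2 ⟧ * (c * f)              ∎)
    where
    unit-* : ∀ y → f * f⁻¹ * y ≈ y
    unit-* y = trans (*-congʳ unit)
      (solve 1 (λ y → con (+ 1) :* y := y) refl y)

  -- The Pell equation and the roots built from it.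

  -- Origin of M: differentiating the Pell equation shows that L times the left side of `MS` is 64xS
  -- times the left side here. As L is coprime to 64xS by the same equation, one quotient M serves
  -- both identities.
  LM : (S x + ⟦ + 2 ⟧ * (s₁ * x)) * B x + S x * θB/2 x ≈ M x * L x
  LM = solve 2 (λ t x → (Pₛ.S t x :+ con (+ 2) :* (Pₛ.s₁ t :* x)) :* Pₛ.B t x :+ Pₛ.S t x :* Pₛ.θB/2 t x
       := Pₛ.M t x :* Pₛ.L t x) refl t x

  MS : θQ/2 x * L x + Q x * (⟦ + 2 ⟧ * (l₁ * x)) ≈ ⟦ + 64 ⟧ * x * (M x * S x)
  MS = solve 2 (λ t x → Pₛ.θQ/2 t x :* Pₛ.L t x :+ Pₛ.Q t x :* (con (+ 2) :* (Pₛ.l₁ t :* x))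
       := con (+ 64) :* x :* (Pₛ.M t x :* Pₛ.S t x)) refl t x

  pell : Q x * (L x * L x) - ⟦ + 64 ⟧ * x * (B x * (S x * S x)) ≈ ⟦ + 1 ⟧
  pell = solve 2 (λ t x → Pₛ.Q t x :* (Pₛ.L t x :* Pₛ.L t x)
         :- con (+ 64) :* x :* (Pₛ.B t x :* (Pₛ.S t x :* Pₛ.S t x)) := con (+ 1)) refl t x

  q₀ : Carrier
  q₀ = t * (t * t + t + -1#) * X + ⟦ ℤ.- + 16 ⟧ * (t * t * r) * (X * X * X)

  -- `√Q` and `√B` are only the witnesses of `sqrt`; the roots of Q and B themselves are `a` and
  -- `b`. The same convention holds for `√h` and `∜h`.
  √Q √B a b : Carrier
  √Q = proj₁ (sqrt (+ 16) q₀)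
  √B = proj₁ (sqrt (+ 4) (-1# * r * X))
  a  = ⟦ + 1 ⟧ + ⟦ + 2 ⟧ * ⟦ + 16 ⟧ * (X * √Q)
  b  = ⟦ + 1 ⟧ + ⟦ + 2 ⟧ * ⟦ + 4 ⟧ * (X * √B)

  a²≈Q : a * a ≈ Q x
  a²≈Q = trans (proj₂ (sqrt (+ 16) q₀)) (solve 2 (λ t X →
    con (+ 1) :+ con (+ 4) :* con (+ 16) :* (X :* (t :* (t :* t :+ t :+ Pₛ.-1# t) :* X
       :+ con (ℤ.- + 16) :* (t :* t :* Pₛ.r t) :* (X :* X :* X)))
    := Pₛ.Q t (X :* X)) refl t X)

  b²≈B : b * b ≈ B x
  b²≈B = trans (proj₂ (sqrt (+ 4) (-1# * r * X))) (solve 2 (λ t X →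
    con (+ 1) :+ con (+ 4) :* con (+ 4) :* (X :* (Pₛ.-1# t :* Pₛ.r t :* X))
    := Pₛ.B t (X :* X)) refl t X)

  -- `h` is the fourth power of the future H. Its conjugate, with the sign of √B changed, is its
  -- inverse because `pell` is the norm equation.
  h h⁻¹ h₀ : Carrier
  h   = a * L x + ⟦ + 8 ⟧ * (X * (S x * b))
  h⁻¹ = a * L x - ⟦ + 8 ⟧ * (X * (S x * b))
  h₀  = ⟦ + 4 ⟧ * √Q * L x + ⟦ ℤ.- + 4 ⟧ * (e³ * X) + S x * b

  h-inverse : h * h⁻¹ ≈ ⟦ + 1 ⟧
  h-inverse = begin
    h * h⁻¹
      ≈⟨ solve 5 (λ X a b L S →
           (a :* L :+ con (+ 8) :* (X :* (S :* b))) :* (a :* L :- con (+ 8) :* (X :* (S :* b)))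
         := a :* a :* (L :* L) :- con (+ 64) :* (X :* X) :* (b :* b :* (S :* S)))
         refl X a b (L x) (S x) ⟩
    a * a * (L x * L x) - ⟦ + 64 ⟧ * x * (b * b * (S x * S x))
      ≈⟨ +-cong (*-congʳ a²≈Q) (-‿cong (*-congˡ (*-congʳ b²≈B))) ⟩
    Q x * (L x * L x) - ⟦ + 64 ⟧ * x * (B x * (S x * S x))  ≈⟨ pell ⟩
    ⟦ + 1 ⟧  ∎

  h≈1+8Xh₀ : ⟦ + 1 ⟧ + ⟦ + 4 ⟧ * ⟦ + 2 ⟧ * (X * h₀) ≈ h
  h≈1+8Xh₀ = solve 4 (λ t X √Q b → let x = X :* X in
    con (+ 1) :+ con (+ 4) :* con (+ 2) :* (X :* (con (+ 4) :* √Q :* Pₛ.L t x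
      :+ con (ℤ.- + 4) :* (Pₛ.e³ t :* X) :+ Pₛ.S t x :* b))
    := (con (+ 1) :+ con (+ 2) :* con (+ 16) :* (X :* √Q)) :* Pₛ.L t x
      :+ con (+ 8) :* (X :* (Pₛ.S t x :* b))) refl t X √Q b

  -- Each extraction halves the modulus: h is 1 modulo 8X, `h½` is 1 modulo 4X and `H` is 1 modulo
  -- 2X. The factor 8 in `h≈1+8Xh₀` thus allows a fourth root.
  √h ∜h h½ H : Carrier
  √h = proj₁ (sqrt (+ 2) h₀)
  ∜h = proj₁ (sqrt (+ 1) √h)
  h½ = ⟦ + 1 ⟧ + ⟦ + 2 ⟧ * ⟦ + 2 ⟧ * (X * √h)
  H  = ⟦ + 1 ⟧ + ⟦ + 2 ⟧ * ⟦ + 1 ⟧ * (X * ∜h)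

  h½²≈h : h½ * h½ ≈ h
  h½²≈h = trans (proj₂ (sqrt (+ 2) h₀)) h≈1+8Xh₀

  H²≈h½ : H * H ≈ h½
  H²≈h½ = trans (proj₂ (sqrt (+ 1) √h)) (solve 2 (λ X √h →
    con (+ 1) :+ con (+ 4) :* con (+ 1) :* (X :* √h)
    := con (+ 1) :+ con (+ 2) :* con (+ 2) :* (X :* √h)) refl X √h)

  -- Differential equations for H and G.

  a-θ : a * θ a ≈ θQ/2 x
  a-θ = half-derivative a²≈Q θ-Q

  b-θ : b * θ b ≈ θB/2 x
  b-θ = half-derivative b²≈B (θ-linear (θ-⟦⟧ _) b₁ᶜ)

  θ-h : θ h ≈ θ a * L x + a * (⟦ + 2 ⟧ * (l₁ * x))
            + ⟦ + 8 ⟧ * (X * (S x * b) + X * (⟦ + 2 ⟧ * (s₁ * x) * b + S x * θ b))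
  θ-h = trans (θ-+ _ _) (+-cong
    (trans (θ-* _ _) (+-congˡ (*-congˡ (θ-linear (θ-⟦⟧ _) l₁ᶜ))))
    (trans (θ-scale (θ-⟦⟧ _) _) (*-congˡ (trans (θ-* _ _) (+-cong (*-congʳ θ-X)
      (*-congˡ (trans (θ-* _ _) (+-congʳ (*-congʳ (θ-linear m₀ᶜ s₁ᶜ))))))))))

  h-ode : a * b * θ h ≈ ⟦ + 2 ⟧ * (⟦ + 4 ⟧ * (X * M x) * h)
  h-ode = begin
    a * b * θ h  ≈⟨ *-congˡ θ-h ⟩
    a * b * (θ a * L x + a * (⟦ + 2 ⟧ * (l₁ * x))
      + ⟦ + 8 ⟧ * (X * (S x * b) + X * (⟦ + 2 ⟧ * (s₁ * x) * b + S x * θ b)))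
      -- Regrouped so that, apart from a single outer `a` or `b`, the roots occur only in a², b²,
      -- aθa and bθb, which are polynomials in x.
      ≈⟨ solve 9 (λ X a b a′ b′ L S l s →
           a :* b :* (a′ :* L :+ a :* l :+ con (+ 8) :* (X :* (S :* b) :+ X :* (s :* b :+ S :* b′)))
           := b :* (a :* a′ :* L :+ a :* a :* l)
             :+ con (+ 8) :* (X :* (a :* ((S :+ s) :* (b :* b) :+ S :* (b :* b′)))))
         refl X a b (θ a) (θ b) (L x) (S x) (⟦ + 2 ⟧ * (l₁ * x)) (⟦ + 2 ⟧ * (s₁ * x)) ⟩
    b * (a * θ a * L x + a * a * (⟦ + 2 ⟧ * (l₁ * x)))
      + ⟦ + 8 ⟧ * (X * (a * ((S x + ⟦ + 2 ⟧ * (s₁ * x)) * (b * b) + S x * (b * θ b))))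
      ≈⟨ +-cong (*-congˡ (+-cong (*-congʳ a-θ) (*-congʳ a²≈Q)))
           (*-congˡ (*-congˡ (*-congˡ (+-cong (*-congˡ b²≈B) (*-congˡ b-θ))))) ⟩
    b * (θQ/2 x * L x + Q x * (⟦ + 2 ⟧ * (l₁ * x)))
      + ⟦ + 8 ⟧ * (X * (a * ((S x + ⟦ + 2 ⟧ * (s₁ * x)) * B x + S x * θB/2 x)))
      ≈⟨ +-cong (*-congˡ MS) (*-congˡ (*-congˡ (*-congˡ LM))) ⟩
    b * (⟦ + 64 ⟧ * x * (M x * S x)) + ⟦ + 8 ⟧ * (X * (a * (M x * L x)))
      ≈⟨ solve 6 (λ X a b L S M →
           b :* (con (+ 64) :* (X :* X) :* (M :* S)) :+ con (+ 8) :* (X :* (a :* (M :* L)))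
           := con (+ 2) :* (con (+ 4) :* (X :* M) :* (a :* L :+ con (+ 8) :* (X :* (S :* b)))))
         refl X a b (L x) (S x) (M x) ⟩
    ⟦ + 2 ⟧ * (⟦ + 4 ⟧ * (X * M x) * h)  ∎

  unit-√ : ∀ {f g g⁻¹} → f * f ≈ g → g * g⁻¹ ≈ ⟦ + 1 ⟧ → f * (f * g⁻¹) ≈ ⟦ + 1 ⟧
  unit-√ p unit = trans (sym (*-assoc _ _ _)) (trans (*-congʳ p) unit)

  h½-ode : a * b * θ h½ ≈ ⟦ + 2 ⟧ * (⟦ + 2 ⟧ * (X * M x) * h½)
  h½-ode = trans (sqrt-solution h½²≈h (unit-√ h½²≈h h-inverse) h-ode)
    (solve 2 (λ y f → con (+ 4) :* y :* f := con (+ 2) :* (con (+ 2) :* y :* f)) refl _ _)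

  H-ode : a * b * θ H ≈ ⟦ + 2 ⟧ * (X * M x) * H
  H-ode = sqrt-solution H²≈h½ (unit-√ H²≈h½ (unit-√ h½²≈h h-inverse)) h½-ode

  -- Here ab = 1 + X`d₀`, and `d₀⁻¹` is the witness of `inverse`, not an inverse of `d₀`; the
  -- inverse of ab = √(BQ) is `d⁻¹`.
  d₀ d₀⁻¹ d⁻¹ G : Carrier
  d₀   = ⟦ + 32 ⟧ * √Q + ⟦ + 8 ⟧ * √B + ⟦ + 256 ⟧ * (X * (√Q * √B))
  d₀⁻¹ = proj₁ (inverse d₀)
  d⁻¹  = ⟦ + 1 ⟧ + X * d₀⁻¹
  G    = H * d⁻¹

  d-inverse : a * b * d⁻¹ ≈ ⟦ + 1 ⟧
  d-inverse = trans
    (*-congʳ (solve 3 (λ X √Q √B →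
       (con (+ 1) :+ con (+ 2) :* con (+ 16) :* (X :* √Q)) :* (con (+ 1) :+ con (+ 2) :* con (+ 4) :* (X :* √B))
       := con (+ 1) :+ X :* (con (+ 32) :* √Q :+ con (+ 8) :* √B :+ con (+ 256) :* (X :* (√Q :* √B))))
       refl X √Q √B))
    (proj₂ (inverse d₀))

  d-* : ∀ f → a * b * (f * d⁻¹) ≈ f
  d-* f = begin
    a * b * (f * d⁻¹)
      ≈⟨ solve 3 (λ d f i → d :* (f :* i) := d :* i :* f) refl (a * b) f d⁻¹ ⟩
    a * b * d⁻¹ * f  ≈⟨ *-congʳ d-inverse ⟩
    ⟦ + 1 ⟧ * f      ≈⟨ solve 1 (λ f → con (+ 1) :* f := f) refl f ⟩
    f                ∎

  G≈1+X : G ≈ ⟦ + 1 ⟧ + X * (⟦ + 2 ⟧ * ∜h + d₀⁻¹ + ⟦ + 2 ⟧ * (X * (∜h * d₀⁻¹)))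
  G≈1+X = solve 3 (λ X h d →
    (con (+ 1) :+ con (+ 2) :* con (+ 1) :* (X :* h)) :* (con (+ 1) :+ X :* d)
    := con (+ 1) :+ X :* (con (+ 2) :* h :+ d :+ con (+ 2) :* (X :* (h :* d)))) refl X ∜h d₀⁻¹

  θ-H : θ H ≈ ⟦ + 2 ⟧ * (X * M x) * G
  θ-H = begin
    θ H                    ≈⟨ d-* (θ H) ⟨
    a * b * (θ H * d⁻¹)    ≈⟨ *-assoc _ _ _ ⟨
    a * b * θ H * d⁻¹      ≈⟨ *-congʳ H-ode ⟩
    ⟦ + 2 ⟧ * (X * M x) * H * d⁻¹  ≈⟨ *-assoc _ _ _ ⟩
    ⟦ + 2 ⟧ * (X * M x) * G        ∎

  -- This is abθ(abG) = abθH with the product rule applied; the outer factor ab clears all roots on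
  -- the left.
  θ-G : Q x * B x * θ G + (θQ/2 x * B x + Q x * θB/2 x) * G ≈ ⟦ + 2 ⟧ * (X * M x) * H
  θ-G = begin
    Q x * B x * θ G + (θQ/2 x * B x + Q x * θB/2 x) * G
      ≈⟨ +-cong (*-congʳ (*-cong a²≈Q b²≈B))
           (*-congʳ (+-cong (*-cong a-θ b²≈B) (*-cong a²≈Q b-θ))) ⟨
    a * a * (b * b) * θ G + (a * θ a * (b * b) + a * a * (b * θ b)) * G
      ≈⟨ solve 6 (λ a b a′ b′ g g′ →
           a :* a :* (b :* b) :* g′ :+ (a :* a′ :* (b :* b) :+ a :* a :* (b :* b′)) :* g
           := a :* b :* ((a′ :* b :+ a :* b′) :* g :+ a :* b :* g′)) refl a b (θ a) (θ b) G (θ G) ⟩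
    a * b * ((θ a * b + a * θ b) * G + a * b * θ G)
      ≈⟨ *-congˡ (trans (+-congʳ (*-congʳ (sym (θ-* a b)))) (sym (θ-* (a * b) G))) ⟩
    a * b * θ (a * b * G)  ≈⟨ *-congˡ (θ-cong (d-* H)) ⟩
    a * b * θ H            ≈⟨ H-ode ⟩
    ⟦ + 2 ⟧ * (X * M x) * H  ∎

  θ-x* : ∀ f → θ (x * f) ≈ ⟦ + 2 ⟧ * (x * f) + x * θ f
  θ-x* f = trans (θ-* x f) (+-congʳ (trans (*-congʳ θ-x) (*-assoc _ _ _)))

  -- The factor X in θH = 2XMG links odd coefficients of H to even ones of G. Passing to XH makes
  -- both even, and the other factors are polynomials in x, so the even coefficients form a closed
  -- system.
  θ-XH : θ (X * H) ≈ X * H + ⟦ + 2 ⟧ * (m₀ * (x * G)) + ⟦ + 2 ⟧ * (m₁ * (x * (x * G)))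
  θ-XH = trans (θ-* X H) (trans (+-cong (*-congʳ θ-X) (*-congˡ θ-H))
    (solve 5 (λ X H G m₀ m₁ → let x = X :* X in
      X :* H :+ X :* (con (+ 2) :* (X :* (m₀ :+ m₁ :* x)) :* G)
      := X :* H :+ con (+ 2) :* (m₀ :* (x :* G)) :+ con (+ 2) :* (m₁ :* (x :* (x :* G))))
      refl X H G m₀ m₁))

  -- If p is the coefficient of xʲ in QB, its contribution is p(xʲθG + j xʲG) = p(θ(xʲG) - j xʲG),
  -- whence the multiples 1, 2, 3. With θ outermost, coefficients can be read off directly.
  θ-G-expanded :
    θ G + (q₁ + b₁) * (θ (x * G) - x * G)
        + (q₂ + q₁ * b₁) * (θ (x * (x * G)) - ⟦ + 2 ⟧ * (x * (x * G)))
        + q₂ * b₁ * (θ (x * (x * (x * G))) - ⟦ + 3 ⟧ * (x * (x * (x * G))))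
    ≈ ⟦ + 2 ⟧ * (m₀ * (X * H)) + ⟦ + 2 ⟧ * (m₁ * (x * (X * H)))
  θ-G-expanded = begin
    θ G + (q₁ + b₁) * (θ G₁ - G₁) + (q₂ + q₁ * b₁) * (θ G₂ - ⟦ + 2 ⟧ * G₂)
      + q₂ * b₁ * (θ (x * G₂) - ⟦ + 3 ⟧ * (x * G₂))
      ≈⟨ +-cong (+-cong (+-congˡ (*-congˡ (+-congʳ θ-G₁))) (*-congˡ (+-congʳ θ-G₂)))
           (*-congˡ (+-congʳ (trans (θ-x* G₂) (+-congˡ (*-congˡ θ-G₂))))) ⟩
    θ G + (q₁ + b₁) * (⟦ + 2 ⟧ * G₁ + x * θ G - G₁)
      + (q₂ + q₁ * b₁) * (⟦ + 2 ⟧ * G₂ + x * (⟦ + 2 ⟧ * G₁ + x * θ G) - ⟦ + 2 ⟧ * G₂)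
      + q₂ * b₁ * (⟦ + 2 ⟧ * (x * G₂) + x * (⟦ + 2 ⟧ * G₂ + x * (⟦ + 2 ⟧ * G₁ + x * θ G)) - ⟦ + 3 ⟧ * (x * G₂))
      ≈⟨ solve 6 (λ q₁ q₂ b₁ x g g′ →
          g′ :+ (q₁ :+ b₁) :* (con (+ 2) :* (x :* g) :+ x :* g′ :- x :* g)
            :+ (q₂ :+ q₁ :* b₁) :* (con (+ 2) :* (x :* (x :* g)) :+ x :* (con (+ 2) :* (x :* g) :+ x :* g′)
                 :- con (+ 2) :* (x :* (x :* g)))
            :+ q₂ :* b₁ :* (con (+ 2) :* (x :* (x :* (x :* g))) :+ x :* (con (+ 2) :* (x :* (x :* g))
                 :+ x :* (con (+ 2) :* (x :* g) :+ x :* g′)) :- con (+ 3) :* (x :* (x :* (x :* g))))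
          := (con (+ 1) :+ q₁ :* x :+ q₂ :* (x :* x)) :* (con (+ 1) :+ b₁ :* x) :* g′
            :+ ((q₁ :* x :+ con (+ 2) :* q₂ :* (x :* x)) :* (con (+ 1) :+ b₁ :* x)
               :+ (con (+ 1) :+ q₁ :* x :+ q₂ :* (x :* x)) :* (b₁ :* x)) :* g)
          refl q₁ q₂ b₁ x G (θ G) ⟩
    Q x * B x * θ G + (θQ/2 x * B x + Q x * θB/2 x) * G  ≈⟨ θ-G ⟩
    ⟦ + 2 ⟧ * (X * M x) * H
      ≈⟨ solve 5 (λ X x H m₀ m₁ → con (+ 2) :* (X :* (m₀ :+ m₁ :* x)) :* H
           := con (+ 2) :* (m₀ :* (X :* H)) :+ con (+ 2) :* (m₁ :* (x :* (X :* H)))) refl X x H m₀ m₁ ⟩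
    ⟦ + 2 ⟧ * (m₀ * (X * H)) + ⟦ + 2 ⟧ * (m₁ * (x * (X * H)))  ∎
    where
    G₁ = x * G
    G₂ = x * G₁

    θ-G₁ : θ G₁ ≈ ⟦ + 2 ⟧ * G₁ + x * θ G
    θ-G₁ = θ-x* G

    θ-G₂ : θ G₂ ≈ ⟦ + 2 ⟧ * G₂ + x * (⟦ + 2 ⟧ * G₁ + x * θ G)
    θ-G₂ = trans (θ-x* G₁) (+-congˡ (*-congˡ θ-G₁))

-- The recurrence for v and for its product with C(2n,n).

-- α, β and γ have the shape of A, B and Cₙ; w stands for their n-dependent scalars.
module Recurrence {A : Set} (add sub mul : A → A → A) (⟦_⟧ : ℤ → A) (t : A) where
  private
    infixl 6 _+_ _-_
    infixl 7 _*_

    _+_ _-_ _*_ : A → A → A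
    _+_ = add
    _-_ = sub
    _*_ = mul

  infixl 20 _^_

  _^_ : A → ℕ → A
  p ^ zero  = ⟦ + 1 ⟧
  p ^ suc m = p * p ^ m

  α β : A → A
  α w = ⟦ + 4 ⟧ *
        (w * (t ^ 4 - ⟦ + 6 ⟧ * t ^ 3 - ⟦ + 4 ⟧ * t ^ 2 + ⟦ + 6 ⟧ * t - ⟦ + 1 ⟧)
        + (⟦ + 4 ⟧ * t ^ 4 - ⟦ + 24 ⟧ * t ^ 3 - ⟦ + 12 ⟧ * t ^ 2 + ⟦ + 20 ⟧ * t - ⟦ + 3 ⟧))
  β w = ⟦ + 2048 ⟧ * t * (t - ⟦ + 1 ⟧) ^ 3 * (t + ⟦ + 1 ⟧) *
        (w * (t ^ 2 + ⟦ + 2 ⟧ * t - ⟦ + 1 ⟧)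
        - ⟦ + 2 ⟧ * t ^ 2 - ⟦ + 6 ⟧ * t + ⟦ + 3 ⟧)

  γ : A
  γ = ⟦ + 262144 ⟧ * t ^ 2 * (t - ⟦ + 1 ⟧) ^ 6 * (t + ⟦ + 1 ⟧) ^ 2

-- v¹ n and v² n stand for v (n-1) and v (n-2). No initial values are required of
-- them, because at negative indices they occur only with zero coefficients.
record Solution (K : CommutativeRing 0ℓ 0ℓ) (φ : IntegersTo K)
                (t : CommutativeRing.Carrier K) : Set where
  open CommutativeRing K
  open _-Raw-AlmostCommutative⟶_ φ using (⟦_⟧)
  open Recurrence _+_ _-_ _*_ ⟦_⟧ t using (α; β; γ)
  field
    v v¹ v²      : ℕ → Carrier
    v-zero       : v 0 ≈ 1#
    v¹-suc       : ∀ n → v¹ (suc n) ≈ v n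
    v²-suc       : ∀ n → v² (suc n) ≈ v¹ n
    u-recurrence : ∀ n {c⁺ c c¹ c²} →
      (+ n ℤ.+ + 1) ℤ.* c⁺ ≡ + 2 ℤ.* (+ 2 ℤ.* + n ℤ.+ + 1) ℤ.* c →
      (+ n ℤ.+ + 0) ℤ.* c ≡ + 2 ℤ.* (+ 2 ℤ.* + n ℤ.+ ℤ.- + 1) ℤ.* c¹ →
      (+ n ℤ.+ ℤ.- + 1) ℤ.* c¹ ≡ + 2 ℤ.* (+ 2 ℤ.* + n ℤ.+ ℤ.- + 3) ℤ.* c² →
      α ⟦ + 16 ℤ.* (+ n ℤ.* + n ℤ.+ + n) ⟧ * (⟦ c ⟧ * v n)
        + β ⟦ + 8 ℤ.* (+ n ℤ.* + n) ⟧ * (⟦ c¹ ⟧ * v¹ n)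
        - γ * ⟦ (+ 2 ℤ.* + n ℤ.+ + 1) ℤ.* (+ 2 ℤ.* + n ℤ.- + 3) ⟧ * (⟦ c² ⟧ * v² n)
      ≈ ⟦ + (suc n ℕ.* suc n) ⟧ * (⟦ c⁺ ⟧ * v (suc n))

double : ℕ → ℕ
double zero    = zero
double (suc n) = suc (suc (double n))

module Coefficients (K : CommutativeRing 0ℓ 0ℓ) (φ : IntegersTo K)
                    (tf : TorsionFree K φ) (t : CommutativeRing.Carrier K) where
  open CommutativeRing K
  open _-Raw-AlmostCommutative⟶_ φ using (⟦_⟧; +-homo; *-homo; 1-homo)
  private
    module PS = PowerSeries K φ
  open PS using (Series; _≋_; _⊠_; C; X; seriesRing; constants;
    C-⊠; ⊠-cong; ⊠-assoc; X-⊠-suc)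

  derivation : XAdicDerivation seriesRing constants
  derivation = record
    { θ = PS.θ ; θ-cong = λ p k → *-congˡ (p k) ; θ-+ = PS.θ-⊞ ; θ-* = PS.θ-⊠
    ; θ-⟦⟧ = λ i → PS.θ-C ⟦ i ⟧ ; X = X ; t = C t
    ; θ-X = PS.θ-X ; θ-t = PS.θ-C t ; quadratic = PS.quadratic }

  module D = Differential seriesRing constants (PS.torsionFree tf) derivation
  module PK = Parameters _+_ _*_ ⟦_⟧ t
  open IntegerSolver K φ
  open TorsionFree tf
  open import Relation.Binary.Reasoning.Setoid setoid
  module Pₛ {n} = Parameters (_:+_ {n}) _:*_ con
  module Rₛ {n} = Recurrence (_:+_ {n}) _:-_ _:*_ con

  -- In degree j+1 the equation θc = 0 says (j+1)c_{j+1} = 0, and torsion-freeness leaves only c₀.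
  constant-⊠ : ∀ {c} → D.Constant c → ∀ f k → (c ⊠ f) k ≈ c 0 * f k
  constant-⊠ {c} p f k = trans (⊠-cong c≋C (λ _ → refl) k) (C-⊠ (c 0) f k)
    where
    c≋C : c ≋ C (c 0)
    c≋C zero    = refl
    c≋C (suc j) = cancel (+ suc j) _ _ (trans (p (suc j)) (sym (zeroʳ _)))

  even : Series → Series
  even f n = f (double n)

  X²-⊠-suc : ∀ f k → (D.x ⊠ f) (suc (suc k)) ≈ f k
  X²-⊠-suc f k = trans (⊠-assoc X X f (suc (suc k)))
    (trans (X-⊠-suc (X ⊠ f) (suc k)) (X-⊠-suc f k))

  G₁ G₂ H₁ : Series
  G₁ = D.x ⊠ D.G
  G₂ = D.x ⊠ G₁
  H₁ = X ⊠ D.H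

  H₁-coefficient : ∀ k → ⟦ + k ⟧ * H₁ k ≈
    H₁ k + ⟦ + 2 ⟧ * (PK.m₀ * G₁ k) + ⟦ + 2 ⟧ * (PK.m₁ * G₂ k)
  H₁-coefficient k = trans (D.θ-XH k) (+-cong
    (+-congˡ (trans (C-⊠ _ _ k) (*-congˡ (constant-⊠ D.m₀ᶜ _ k))))
    (trans (C-⊠ _ _ k) (*-congˡ (constant-⊠ D.m₁ᶜ _ k))))

  -- Only one factor x is stripped from each product. The coefficients of `G₁` and `G₂` stand for
  -- those of G at lower, possibly negative, indices, so small k need no separate case.
  G-coefficient : ∀ k → let n = ⟦ + suc (suc k) ⟧ in
    n * D.G (suc (suc k)) + (PK.q₁ + PK.b₁) * (n * D.G k - D.G k)
      + (PK.q₂ + PK.q₁ * PK.b₁) * (n * G₁ k - ⟦ + 2 ⟧ * G₁ k)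
      + PK.q₂ * PK.b₁ * (n * G₂ k - ⟦ + 3 ⟧ * G₂ k)
    ≈ ⟦ + 2 ⟧ * (PK.m₀ * H₁ (suc (suc k))) + ⟦ + 2 ⟧ * (PK.m₁ * H₁ k)
  G-coefficient k = trans (sym (+-cong (+-cong (+-congˡ
      (trans (constant-⊠ (D.q₁ᶜ D.+ᶜ D.b₁ᶜ) _ k₂) (*-congˡ (+-cong (*-congˡ (shift D.G)) (-‿cong (shift D.G))))))
      (trans (constant-⊠ (D.q₂ᶜ D.+ᶜ D.q₁ᶜ D.*ᶜ D.b₁ᶜ) _ k₂)
        (*-congˡ (+-cong (*-congˡ (shift G₁)) (-‿cong (trans (C-⊠ _ _ k₂) (*-congˡ (shift G₁))))))))
      (trans (constant-⊠ (D.q₂ᶜ D.*ᶜ D.b₁ᶜ) _ k₂)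
        (*-congˡ (+-cong (*-congˡ (shift G₂)) (-‿cong (trans (C-⊠ _ _ k₂) (*-congˡ (shift G₂)))))))))
    (trans (D.θ-G-expanded k₂) (+-cong
      (trans (C-⊠ _ _ k₂) (*-congˡ (constant-⊠ D.m₀ᶜ _ k₂)))
      (trans (C-⊠ _ _ k₂) (*-congˡ (trans (constant-⊠ D.m₁ᶜ _ k₂) (*-congˡ (shift H₁)))))))
    where
    k₂ = suc (suc k)
    shift : ∀ f → (D.x ⊠ f) k₂ ≈ f k
    shift f = X²-⊠-suc f k

  X²-⊠-even : ∀ f n → even (D.x ⊠ f) (suc n) ≈ even f n
  X²-⊠-even f n = X²-⊠-suc f (double n)

  v v¹ v² : ℕ → Carrier
  v  = even D.G
  v¹ = even G₁
  v² = even G₂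

  v-zero : v 0 ≈ 1#
  v-zero = trans (D.G≈1+X 0) (trans (+-cong 1-homo (zeroˡ _)) (+-identityʳ 1#))

  module _ (n : ℕ) where
    private
      N = ⟦ + n ⟧
    open Recurrence _+_ _-_ _*_ ⟦_⟧ t

    2N-1 2N+1 2N-3 αₙ βₙ : Carrier
    2N-1 = ⟦ + 2 ⟧ * N + ⟦ ℤ.- + 1 ⟧
    2N+1 = ⟦ + 2 ⟧ * N + ⟦ + 1 ⟧
    2N-3 = ⟦ + 2 ⟧ * N + ⟦ ℤ.- + 3 ⟧
    αₙ = α (⟦ + 16 ⟧ * (N * N + N))
    βₙ = β (⟦ + 8 ⟧ * (N * N))

    double-homo : ⟦ + double n ⟧ ≈ ⟦ + 2 ⟧ * N
    double-homo = trans (reflexive (≡.cong ⟦_⟧ (≡.trans (≡.cong +_ (double-≡ n)) (ℤ.pos-* 2 n))))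
      (*-homo (+ 2) (+ n))
      where
      double-≡ : ∀ n → double n ≡ 2 ℕ.* n
      double-≡ zero    = ≡.refl
      double-≡ (suc n) = ≡.cong suc (≡.trans (≡.cong suc (double-≡ n)) (≡.sym (ℕ.+-suc n _)))

    odd-homo : ⟦ + double n ℤ.- + 1 ⟧ ≈ 2N-1
    odd-homo = trans (+-homo (+ double n) (ℤ.- + 1)) (+-congʳ double-homo)

    double-suc-homo : ⟦ + double (suc n) ⟧ ≈ ⟦ + 2 ⟧ + ⟦ + 2 ⟧ * N
    double-suc-homo = trans (+-homo (+ 2) (+ double n)) (+-congˡ double-homo)

    odd-nonZero : ℤ.NonZero (+ double n ℤ.- + 1)
    odd-nonZero = go n
      where
      go : ∀ n → ℤ.NonZero (+ double n ℤ.- + 1)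
      go zero    = _
      go (suc n) = _

    -- Moving the summand XH of θ(XH) to the left turns 2n into 2n - 1. Instead of dividing,
    -- `v-recurrence` is multiplied by this factor and by the 2n + 1 of `H₁-even-suc` before H is
    -- eliminated.
    H₁-even : 2N-1 * even H₁ n ≈ ⟦ + 2 ⟧ * (PK.m₀ * v¹ n) + ⟦ + 2 ⟧ * (PK.m₁ * v² n)
    H₁-even = begin
      2N-1 * η      ≈⟨ solve 2 (λ N η → (con (+ 2) :* N :+ con (ℤ.- + 1)) :* η
                         := con (+ 2) :* N :* η :- η) refl N η ⟩
      ⟦ + 2 ⟧ * N * η - η    ≈⟨ +-congʳ (trans (*-congʳ (sym double-homo)) (H₁-coefficient (double n))) ⟩
      η + y + z - η ≈⟨ solve 3 (λ η y z → η :+ y :+ z :- η := y :+ z) refl η y z ⟩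
      y + z         ∎
      where
      η = even H₁ n
      y = ⟦ + 2 ⟧ * (PK.m₀ * v¹ n)
      z = ⟦ + 2 ⟧ * (PK.m₁ * v² n)

    H₁-even-suc : 2N+1 * even H₁ (suc n) ≈ ⟦ + 2 ⟧ * (PK.m₀ * v n) + ⟦ + 2 ⟧ * (PK.m₁ * v¹ n)
    H₁-even-suc = begin
      2N+1 * η      ≈⟨ solve 2 (λ N η → (con (+ 2) :* N :+ con (+ 1)) :* η
                         := (con (+ 2) :+ con (+ 2) :* N) :* η :- η) refl N η ⟩
      (⟦ + 2 ⟧ + ⟦ + 2 ⟧ * N) * η - η
        ≈⟨ +-congʳ (trans (*-congʳ (sym double-suc-homo)) (H₁-coefficient (double (suc n)))) ⟩
      η + ⟦ + 2 ⟧ * (PK.m₀ * v¹ (suc n)) + ⟦ + 2 ⟧ * (PK.m₁ * v² (suc n)) - η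
        ≈⟨ +-congʳ (+-cong (+-congˡ (*-congˡ (*-congˡ (X²-⊠-even D.G n))))
                           (*-congˡ (*-congˡ (X²-⊠-even G₁ n)))) ⟩
      η + y + z - η ≈⟨ solve 3 (λ η y z → η :+ y :+ z :- η := y :+ z) refl η y z ⟩
      y + z         ∎
      where
      η = even H₁ (suc n)
      y = ⟦ + 2 ⟧ * (PK.m₀ * v n)
      z = ⟦ + 2 ⟧ * (PK.m₁ * v¹ n)

    v-recurrence : ⟦ + 8 ⟧ * (2N-1 * (N + ⟦ + 1 ⟧) * 2N+1 * v (suc n)) ≈
      ⟦ + 4 ⟧ * (2N-1 * αₙ * v n) + ⟦ + 2 ⟧ * (N * βₙ * v¹ n)
        - N * (N + PK.-1#) * 2N+1 * γ * v² n
    v-recurrence = begin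
      ⟦ + 8 ⟧ * (2N-1 * (N + ⟦ + 1 ⟧) * 2N+1 * v (suc n))
        -- The first bracket is the left side of `G-coefficient` with m = 2n + 2. Its summand
        -- 2(n+1)v(n+1) explains the factor 8; its other summands are subtracted again as `rest`.
        ≈⟨ solve 8 (λ N g′ g g¹ g² p q s →
             con (+ 8) :* (P2N-1 N :* (N :+ con (+ 1)) :* P2N+1 N :* g′)
             := con (+ 4) :* (P2N-1 N :* P2N+1 N) :* ((con (+ 2) :+ con (+ 2) :* N) :* g′
                   :+ p :* ((con (+ 2) :+ con (+ 2) :* N) :* g :- g)
                   :+ q :* ((con (+ 2) :+ con (+ 2) :* N) :* g¹ :- con (+ 2) :* g¹)
                   :+ s :* ((con (+ 2) :+ con (+ 2) :* N) :* g² :- con (+ 3) :* g²))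
                :- con (+ 4) :* (P2N-1 N :* P2N+1 N) :* (p :* (P2N+1 N :* g)
                   :+ q :* (con (+ 2) :* N :* g¹) :+ s :* (P2N-1 N :* g²)))
             refl N (v (suc n)) (v n) (v¹ n) (v² n) (q₁ + b₁) (q₂ + q₁ * b₁) (q₂ * b₁) ⟩
      ⟦ + 4 ⟧ * (2N-1 * 2N+1) * (m * v (suc n) + (q₁ + b₁) * (m * v n - v n)
           + (q₂ + q₁ * b₁) * (m * v¹ n - ⟦ + 2 ⟧ * v¹ n) + q₂ * b₁ * (m * v² n - ⟦ + 3 ⟧ * v² n))
        - rest
        ≈⟨ +-congʳ (*-congˡ (trans
             (+-cong (+-cong (+-cong (*-congʳ m≈) (*-congˡ (+-congʳ (*-congʳ m≈))))
               (*-congˡ (+-congʳ (*-congʳ m≈)))) (*-congˡ (+-congʳ (*-congʳ m≈))))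
             (G-coefficient (double n)))) ⟩
      ⟦ + 4 ⟧ * (2N-1 * 2N+1) * (⟦ + 2 ⟧ * (m₀ * even H₁ (suc n)) + ⟦ + 2 ⟧ * (m₁ * even H₁ n)) - rest
        ≈⟨ +-congʳ (solve 6 (λ a b m₀ m₁ η′ η →
             con (+ 4) :* (a :* b) :* (con (+ 2) :* (m₀ :* η′) :+ con (+ 2) :* (m₁ :* η))
             := con (+ 8) :* (m₀ :* a :* (b :* η′) :+ m₁ :* b :* (a :* η)))
             refl 2N-1 2N+1 m₀ m₁ (even H₁ (suc n)) (even H₁ n)) ⟩
      ⟦ + 8 ⟧ * (m₀ * 2N-1 * (2N+1 * even H₁ (suc n)) + m₁ * 2N+1 * (2N-1 * even H₁ n)) - rest
        ≈⟨ +-congʳ (*-congˡ (+-cong (*-congˡ H₁-even-suc) (*-congˡ H₁-even))) ⟩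
      ⟦ + 8 ⟧ * (m₀ * 2N-1 * (⟦ + 2 ⟧ * (m₀ * v n) + ⟦ + 2 ⟧ * (m₁ * v¹ n))
           + m₁ * 2N+1 * (⟦ + 2 ⟧ * (m₀ * v¹ n) + ⟦ + 2 ⟧ * (m₁ * v² n))) - rest
        -- At v(n) this is α = 4m₀² - (2n+1)²(q₁ + b₁). At v(n-1) the cross terms add up through
        -- (2n-1) + (2n+1) = 4n, which gives the factor n; at v(n-2) the factor n(n-1) arises
        -- because 4m₁² = q₂b₁.
        ≈⟨ solve 5 (λ t N g g¹ g² →
             con (+ 8) :* (Pₛ.m₀ t :* P2N-1 N :* (con (+ 2) :* (Pₛ.m₀ t :* g) :+ con (+ 2) :* (Pₛ.m₁ t :* g¹))
               :+ Pₛ.m₁ t :* P2N+1 N :* (con (+ 2) :* (Pₛ.m₀ t :* g¹) :+ con (+ 2) :* (Pₛ.m₁ t :* g²)))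
             :- con (+ 4) :* (P2N-1 N :* P2N+1 N) :* ((Pₛ.q₁ t :+ Pₛ.b₁ t) :* (P2N+1 N :* g)
                 :+ (Pₛ.q₂ t :+ Pₛ.q₁ t :* Pₛ.b₁ t) :* (con (+ 2) :* N :* g¹)
                 :+ Pₛ.q₂ t :* Pₛ.b₁ t :* (P2N-1 N :* g²))
             := con (+ 4) :* (P2N-1 N :* Rₛ.α t (con (+ 16) :* (N :* N :+ N)) :* g)
               :+ con (+ 2) :* (N :* Rₛ.β t (con (+ 8) :* (N :* N)) :* g¹)
               :- N :* (N :+ con (ℤ.- + 1)) :* P2N+1 N :* Rₛ.γ t :* g²)
             refl t N (v n) (v¹ n) (v² n) ⟩
      ⟦ + 4 ⟧ * (2N-1 * αₙ * v n) + ⟦ + 2 ⟧ * (N * βₙ * v¹ n)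
        - N * (N + PK.-1#) * 2N+1 * γ * v² n  ∎
      where
      open PK using (q₁; q₂; b₁; m₀; m₁)
      P2N-1 P2N+1 : ∀ {k} → Polynomial k → Polynomial k
      P2N-1 N = con (+ 2) :* N :+ con (ℤ.- + 1)
      P2N+1 N = con (+ 2) :* N :+ con (+ 1)
      m    = ⟦ + 2 ⟧ + ⟦ + 2 ⟧ * N
      m≈   = sym double-suc-homo
      rest = ⟦ + 4 ⟧ * (2N-1 * 2N+1) * ((q₁ + b₁) * (2N+1 * v n)
               + (q₂ + q₁ * b₁) * (⟦ + 2 ⟧ * N * v¹ n) + q₂ * b₁ * (2N-1 * v² n))

    -- Multiply `v-recurrence` by c. The ratio relations turn 2(n+1)(2n+1)c into (n+1)²c⁺, nc into
    -- 2(2n-1)c¹, and n(n-1)c into 4(2n-1)(2n-3)c², so every term acquires the factor 4(2n-1), which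
    -- is cancelled.
    u-recurrence : ∀ {c⁺ c c¹ c²} →
      (N + ⟦ + 1 ⟧) * c⁺ ≈ ⟦ + 2 ⟧ * 2N+1 * c →
      N * c ≈ ⟦ + 2 ⟧ * 2N-1 * c¹ →
      (N + PK.-1#) * c¹ ≈ ⟦ + 2 ⟧ * 2N-3 * c² →
      (N + ⟦ + 1 ⟧) * (N + ⟦ + 1 ⟧) * (c⁺ * v (suc n)) ≈
        αₙ * (c * v n) + βₙ * (c¹ * v¹ n) - γ * (2N+1 * 2N-3) * (c² * v² n)
    u-recurrence {c⁺} {c} {c¹} {c²} p q s =
      cancel (+ 4) _ _ (cancel (+ double n ℤ.- + 1) {{odd-nonZero}} _ _ (begin
      ⟦ + double n ℤ.- + 1 ⟧ * (⟦ + 4 ⟧ * ((N + ⟦ + 1 ⟧) * (N + ⟦ + 1 ⟧) * (c⁺ * v (suc n))))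
        ≈⟨ *-congʳ odd-homo ⟩
      2N-1 * (⟦ + 4 ⟧ * ((N + ⟦ + 1 ⟧) * (N + ⟦ + 1 ⟧) * (c⁺ * v (suc n))))
        ≈⟨ solve 4 (λ a M c⁺ g → a :* (con (+ 4) :* (M :* M :* (c⁺ :* g)))
             := con (+ 4) :* (a :* M :* (M :* c⁺) :* g)) refl 2N-1 (N + ⟦ + 1 ⟧) c⁺ (v (suc n)) ⟩
      ⟦ + 4 ⟧ * (2N-1 * (N + ⟦ + 1 ⟧) * ((N + ⟦ + 1 ⟧) * c⁺) * v (suc n))
        ≈⟨ *-congˡ (*-congʳ (*-congˡ p)) ⟩
      ⟦ + 4 ⟧ * (2N-1 * (N + ⟦ + 1 ⟧) * (⟦ + 2 ⟧ * 2N+1 * c) * v (suc n))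
        ≈⟨ solve 5 (λ a M b c g → con (+ 4) :* (a :* M :* (con (+ 2) :* b :* c) :* g)
             := c :* (con (+ 8) :* (a :* M :* b :* g))) refl 2N-1 (N + ⟦ + 1 ⟧) 2N+1 c (v (suc n)) ⟩
      c * (⟦ + 8 ⟧ * (2N-1 * (N + ⟦ + 1 ⟧) * 2N+1 * v (suc n)))  ≈⟨ *-congˡ v-recurrence ⟩
      c * (⟦ + 4 ⟧ * (2N-1 * αₙ * v n) + ⟦ + 2 ⟧ * (N * βₙ * v¹ n)
        - N * (N + PK.-1#) * 2N+1 * γ * v² n)
        ≈⟨ solve 11 (λ N M a b α β γ c g g¹ g² →
             c :* (con (+ 4) :* (a :* α :* g) :+ con (+ 2) :* (N :* β :* g¹) :- N :* M :* b :* γ :* g²)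
             := con (+ 4) :* (a :* α :* (c :* g)) :+ con (+ 2) :* ((N :* c) :* β :* g¹)
                :- (N :* c) :* M :* b :* γ :* g²)
             refl N (N + PK.-1#) 2N-1 2N+1 αₙ βₙ γ c (v n) (v¹ n) (v² n) ⟩
      ⟦ + 4 ⟧ * (2N-1 * αₙ * (c * v n)) + ⟦ + 2 ⟧ * (N * c * βₙ * v¹ n)
        - N * c * (N + PK.-1#) * 2N+1 * γ * v² n
        ≈⟨ +-cong (+-congˡ (*-congˡ (*-congʳ (*-congʳ q))))
             (-‿cong (*-congʳ (*-congʳ (*-congʳ (*-congʳ q))))) ⟩
      ⟦ + 4 ⟧ * (2N-1 * αₙ * (c * v n)) + ⟦ + 2 ⟧ * (⟦ + 2 ⟧ * 2N-1 * c¹ * βₙ * v¹ n)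
        - ⟦ + 2 ⟧ * 2N-1 * c¹ * (N + PK.-1#) * 2N+1 * γ * v² n
        ≈⟨ +-congˡ (-‿cong (solve 6 (λ a c¹ M b γ g² →
             con (+ 2) :* a :* c¹ :* M :* b :* γ :* g² := con (+ 2) :* a :* (M :* c¹) :* b :* γ :* g²)
             refl 2N-1 c¹ (N + PK.-1#) 2N+1 γ (v² n))) ⟩
      ⟦ + 4 ⟧ * (2N-1 * αₙ * (c * v n)) + ⟦ + 2 ⟧ * (⟦ + 2 ⟧ * 2N-1 * c¹ * βₙ * v¹ n)
        - ⟦ + 2 ⟧ * 2N-1 * ((N + PK.-1#) * c¹) * 2N+1 * γ * v² n
        ≈⟨ +-congˡ (-‿cong (*-congʳ (*-congʳ (*-congʳ (*-congˡ s))))) ⟩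
      ⟦ + 4 ⟧ * (2N-1 * αₙ * (c * v n)) + ⟦ + 2 ⟧ * (⟦ + 2 ⟧ * 2N-1 * c¹ * βₙ * v¹ n)
        - ⟦ + 2 ⟧ * 2N-1 * (⟦ + 2 ⟧ * 2N-3 * c²) * 2N+1 * γ * v² n
        ≈⟨ solve 11 (λ a b d α β γ cg c¹ g¹ c² g² → con (+ 4) :* (a :* α :* cg)
               :+ con (+ 2) :* (con (+ 2) :* a :* c¹ :* β :* g¹)
               :- con (+ 2) :* a :* (con (+ 2) :* d :* c²) :* b :* γ :* g²
             := a :* (con (+ 4) :* (α :* cg :+ β :* (c¹ :* g¹) :- γ :* (b :* d) :* (c² :* g²))))
             refl 2N-1 2N+1 2N-3 αₙ βₙ γ (c * v n) c¹ (v¹ n) c² (v² n) ⟩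
      2N-1 * (⟦ + 4 ⟧ * (αₙ * (c * v n) + βₙ * (c¹ * v¹ n) - γ * (2N+1 * 2N-3) * (c² * v² n)))
        ≈⟨ *-congʳ odd-homo ⟨
      ⟦ + double n ℤ.- + 1 ⟧
        * (⟦ + 4 ⟧ * (αₙ * (c * v n) + βₙ * (c¹ * v¹ n) - γ * (2N+1 * 2N-3) * (c² * v² n)))  ∎))

    u-recurrence-ℤ : ∀ {c⁺ c c¹ c²} →
      (+ n ℤ.+ + 1) ℤ.* c⁺ ≡ + 2 ℤ.* (+ 2 ℤ.* + n ℤ.+ + 1) ℤ.* c →
      (+ n ℤ.+ + 0) ℤ.* c ≡ + 2 ℤ.* (+ 2 ℤ.* + n ℤ.+ ℤ.- + 1) ℤ.* c¹ →
      (+ n ℤ.+ ℤ.- + 1) ℤ.* c¹ ≡ + 2 ℤ.* (+ 2 ℤ.* + n ℤ.+ ℤ.- + 3) ℤ.* c² →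
      α ⟦ + 16 ℤ.* (+ n ℤ.* + n ℤ.+ + n) ⟧ * (⟦ c ⟧ * v n)
        + β ⟦ + 8 ℤ.* (+ n ℤ.* + n) ⟧ * (⟦ c¹ ⟧ * v¹ n)
        - γ * ⟦ (+ 2 ℤ.* + n ℤ.+ + 1) ℤ.* (+ 2 ℤ.* + n ℤ.- + 3) ⟧ * (⟦ c² ⟧ * v² n)
      ≈ ⟦ + (suc n ℕ.* suc n) ⟧ * (⟦ c⁺ ⟧ * v (suc n))
    u-recurrence-ℤ {c⁺} {c} {c¹} {c²} p q s = begin
      α ⟦ + 16 ℤ.* (+ n ℤ.* + n ℤ.+ + n) ⟧ * (⟦ c ⟧ * v n)
        + β ⟦ + 8 ℤ.* (+ n ℤ.* + n) ⟧ * (⟦ c¹ ⟧ * v¹ n)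
        - γ * ⟦ (+ 2 ℤ.* + n ℤ.+ + 1) ℤ.* (+ 2 ℤ.* + n ℤ.- + 3) ⟧ * (⟦ c² ⟧ * v² n)
        ≈⟨ +-cong (+-cong (*-congʳ (*-congˡ (+-congʳ (*-congʳ w₁≈))))
                          (*-congʳ (*-congˡ (+-congʳ (+-congʳ (+-congʳ (*-congʳ w₂≈)))))))
                  (-‿cong (*-congʳ (*-congˡ w₃≈))) ⟩
      αₙ * (⟦ c ⟧ * v n) + βₙ * (⟦ c¹ ⟧ * v¹ n) - γ * (2N+1 * 2N-3) * (⟦ c² ⟧ * v² n)
        ≈⟨ u-recurrence (binomial-homo (+ 1) (+ 1) p)
             (trans (solve 2 (λ N c → N :* c := (N :+ con (+ 0)) :* c) refl N ⟦ c ⟧)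
               (binomial-homo (+ 0) (ℤ.- + 1) q))
             (binomial-homo (ℤ.- + 1) (ℤ.- + 3) s) ⟨
      (N + ⟦ + 1 ⟧) * (N + ⟦ + 1 ⟧) * (⟦ c⁺ ⟧ * v (suc n))
        ≈⟨ *-congʳ (trans (reflexive (≡.cong ⟦_⟧ (ℤ.pos-* (suc n) (suc n))))
             (trans (*-homo _ _) (*-cong suc-homo suc-homo))) ⟨
      ⟦ + (suc n ℕ.* suc n) ⟧ * (⟦ c⁺ ⟧ * v (suc n))  ∎
      where
      suc-homo : ⟦ + suc n ⟧ ≈ N + ⟦ + 1 ⟧
      suc-homo = trans (+-homo (+ 1) (+ n)) (+-comm _ _)

      affine-homo : ∀ i → ⟦ + 2 ℤ.* + n ℤ.+ i ⟧ ≈ ⟦ + 2 ⟧ * N + ⟦ i ⟧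
      affine-homo i = trans (+-homo _ i) (+-congʳ (*-homo (+ 2) (+ n)))

      w₁≈ = trans (*-homo (+ 16) _) (*-congˡ (trans (+-homo _ _) (+-congʳ (*-homo (+ n) (+ n)))))
      w₂≈ = trans (*-homo (+ 8) _) (*-congˡ (*-homo (+ n) (+ n)))
      w₃≈ = trans (*-homo _ _) (*-cong (affine-homo (+ 1)) (affine-homo (ℤ.- + 3)))

      binomial-homo : ∀ i j {a b} →
        (+ n ℤ.+ i) ℤ.* a ≡ + 2 ℤ.* (+ 2 ℤ.* + n ℤ.+ j) ℤ.* b →
        (N + ⟦ i ⟧) * ⟦ a ⟧ ≈ ⟦ + 2 ⟧ * (⟦ + 2 ⟧ * N + ⟦ j ⟧) * ⟦ b ⟧
      binomial-homo i j {a} {b} eq = begin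
        (N + ⟦ i ⟧) * ⟦ a ⟧              ≈⟨ *-congʳ (+-homo (+ n) i) ⟨
        ⟦ + n ℤ.+ i ⟧ * ⟦ a ⟧            ≈⟨ *-homo _ _ ⟨
        ⟦ (+ n ℤ.+ i) ℤ.* a ⟧            ≈⟨ reflexive (≡.cong ⟦_⟧ eq) ⟩
        ⟦ + 2 ℤ.* (+ 2 ℤ.* + n ℤ.+ j) ℤ.* b ⟧
          ≈⟨ trans (*-homo _ _) (*-congʳ (trans (*-homo _ _) (*-congˡ (affine-homo j)))) ⟩
        ⟦ + 2 ⟧ * (⟦ + 2 ⟧ * N + ⟦ j ⟧) * ⟦ b ⟧  ∎

  solution : Solution K φ t
  solution = record
    { v = v ; v¹ = v¹ ; v² = v² ; v-zero = v-zero
    ; v¹-suc = X²-⊠-even D.G ; v²-suc = X²-⊠-even G₁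
    ; u-recurrence = u-recurrence-ℤ }

-- From rational polynomials to integral power series.

open import Defs
open import Data.Nat using (_*_; _!)
open import Data.Nat.Combinatorics using (_C_)

ℤ-identity : IntegersTo ℤ.+-*-commutativeRing
ℤ-identity = record
  { ⟦_⟧ = λ i → i ; +-homo = λ _ _ → ≡.refl ; *-homo = λ _ _ → ≡.refl
  ; -‿homo = λ _ → ≡.refl ; 0-homo = ≡.refl ; 1-homo = ≡.refl }

ℤ-torsionFree : TorsionFree ℤ.+-*-commutativeRing ℤ-identity
ℤ-torsionFree = record { cancel = λ i x y → ℤ.*-cancelˡ-≡ i x y }

module ℤ[[t]] = PowerSeries ℤ.+-*-commutativeRing ℤ-identity

module K = CommutativeRing ℤ[[t]].seriesRing

ι-+ : ∀ i j → ι (i ℤ.+ j) ≡ ι i ℚ.+ ι j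
ι-+ i j = ℚ.toℚᵘ-injective (begin
  toℚᵘ (ι (i ℤ.+ j))             ≈⟨ ℚ.toℚᵘ-fromℚᵘ (ℚᵘ.mkℚᵘ (i ℤ.+ j) 0) ⟩
  ℚᵘ.mkℚᵘ (i ℤ.+ j) 0
    ≈⟨ ℚᵘ.*≡* (≡.cong (ℤ._* + 1) (≡.sym (≡.cong₂ ℤ._+_ (ℤ.*-identityʳ i) (ℤ.*-identityʳ j)))) ⟩
  ℚᵘ.mkℚᵘ i 0 ℚᵘ.+ ℚᵘ.mkℚᵘ j 0
    ≈⟨ ℚᵘ.+-cong (ℚ.toℚᵘ-fromℚᵘ (ℚᵘ.mkℚᵘ i 0)) (ℚ.toℚᵘ-fromℚᵘ (ℚᵘ.mkℚᵘ j 0)) ⟨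
  toℚᵘ (ι i) ℚᵘ.+ toℚᵘ (ι j)     ≈⟨ ℚ.toℚᵘ-homo-+ (ι i) (ι j) ⟨
  toℚᵘ (ι i ℚ.+ ι j)             ∎)
  where
  open import Relation.Binary.Reasoning.Setoid ℚᵘ.≃-setoid

ι-* : ∀ i j → ι (i ℤ.* j) ≡ ι i ℚ.* ι j
ι-* i j = ℚ.toℚᵘ-injective (begin
  toℚᵘ (ι (i ℤ.* j))             ≈⟨ ℚ.toℚᵘ-fromℚᵘ (ℚᵘ.mkℚᵘ (i ℤ.* j) 0) ⟩
  ℚᵘ.mkℚᵘ i 0 ℚᵘ.* ℚᵘ.mkℚᵘ j 0
    ≈⟨ ℚᵘ.*-cong (ℚ.toℚᵘ-fromℚᵘ (ℚᵘ.mkℚᵘ i 0)) (ℚ.toℚᵘ-fromℚᵘ (ℚᵘ.mkℚᵘ j 0)) ⟨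
  toℚᵘ (ι i) ℚᵘ.* toℚᵘ (ι j)     ≈⟨ ℚ.toℚᵘ-homo-* (ι i) (ι j) ⟨
  toℚᵘ (ι i ℚ.* ι j)             ∎)
  where
  open import Relation.Binary.Reasoning.Setoid ℚᵘ.≃-setoid

ι-neg : ∀ i → ι (ℤ.- i) ≡ ℚ.- ι i
ι-neg i = ℚ.toℚᵘ-injective (begin
  toℚᵘ (ι (ℤ.- i))       ≈⟨ ℚ.toℚᵘ-fromℚᵘ (ℚᵘ.mkℚᵘ (ℤ.- i) 0) ⟩
  ℚᵘ.- ℚᵘ.mkℚᵘ i 0       ≈⟨ ℚᵘ.-‿cong (ℚ.toℚᵘ-fromℚᵘ (ℚᵘ.mkℚᵘ i 0)) ⟨
  ℚᵘ.- toℚᵘ (ι i)        ≈⟨ ℚ.toℚᵘ-homo‿- (ι i) ⟨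
  toℚᵘ (ℚ.- ι i)         ∎)
  where
  open import Relation.Binary.Reasoning.Setoid ℚᵘ.≃-setoid

1/n*ι : ∀ n .{{_ : ℕ.NonZero n}} z → ((+ 1) ℚ./ n) ℚ.* ι (+ n ℤ.* z) ≡ ι z
1/n*ι n@(suc m) z = ℚ.toℚᵘ-injective (begin
  toℚᵘ (((+ 1) ℚ./ n) ℚ.* ι (+ n ℤ.* z))
    ≈⟨ ℚ.toℚᵘ-homo-* ((+ 1) ℚ./ n) (ι (+ n ℤ.* z)) ⟩
  toℚᵘ ((+ 1) ℚ./ n) ℚᵘ.* toℚᵘ (ι (+ n ℤ.* z))
    ≈⟨ ℚᵘ.*-cong (ℚ.toℚᵘ-fromℚᵘ (ℚᵘ.mkℚᵘ (+ 1) m)) (ℚ.toℚᵘ-fromℚᵘ (ℚᵘ.mkℚᵘ (+ n ℤ.* z) 0)) ⟩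
  ℚᵘ.mkℚᵘ (+ 1) m ℚᵘ.* ℚᵘ.mkℚᵘ (+ n ℤ.* z) 0
    ≈⟨ ℚᵘ.*≡* (solve 2 (λ n z → con (+ 1) :* (n :* z) :* con (+ 1) := z :* (n :* con (+ 1)))
         ≡.refl (+ n) z) ⟩
  ℚᵘ.mkℚᵘ z 0      ≈⟨ ℚ.toℚᵘ-fromℚᵘ (ℚᵘ.mkℚᵘ z 0) ⟨
  toℚᵘ (ι z)       ∎)
  where
  open import Relation.Binary.Reasoning.Setoid ℚᵘ.≃-setoid
  open ℤ.+-*-Solver

-- A record rather than a bare family of equations, so that p and f can be inferred from a proof and
-- the proofs can copy the shape of `A`, `B` and `Cₙ`.
record _reducesTo_ (p : Poly) (f : ℕ → ℤ) : Set where
  constructor coefficients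
  field coefficient : ∀ k → p k ≡ ι (f k)
open _reducesTo_

infix 4 _reducesTo_

⊕-reduces : ∀ {p q f g} → p reducesTo f → q reducesTo g → p ⊕ q reducesTo f K.+ g
⊕-reduces {f = f} {g} P Q = coefficients λ k →
  ≡.trans (≡.cong₂ ℚ._+_ (coefficient P k) (coefficient Q k)) (≡.sym (ι-+ (f k) (g k)))

⊖-reduces : ∀ {p q f g} → p reducesTo f → q reducesTo g → p ⊖ q reducesTo f K.- g
⊖-reduces {f = f} {g} P Q = coefficients λ k → ≡.trans
  (≡.cong₂ ℚ._+_ (coefficient P k) (≡.trans (≡.cong ℚ.-_ (coefficient Q k)) (≡.sym (ι-neg (g k)))))
  (≡.sym (ι-+ (f k) (ℤ.- g k)))

⊗-reduces : ∀ {p q f g} → p reducesTo f → q reducesTo g → p ⊗ q reducesTo f K.* g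
⊗-reduces {p} {q} {f} {g} P Q = coefficients λ k → ≡.trans
  (≡.cong (foldr ℚ._+_ 0ℚ) (map-upTo (λ i → p i ℚ.* q (k ℕ.∸ i)) (suc k)))
  (convolution k f (λ i → p i ℚ.* q (k ℕ.∸ i)) λ i →
    ≡.trans (≡.cong₂ ℚ._*_ (coefficient P i) (coefficient Q (k ℕ.∸ i)))
      (≡.sym (ι-* (f i) (g (k ℕ.∸ i)))))
  where
  -- The summand F is general because peeling off i = 0 shifts it; as suc k ∸ suc i reduces to k ∸
  -- i, the sum then follows the recursion of the series product.
  convolution : ∀ k f F → (∀ i → F i ≡ ι (f i ℤ.* g (k ℕ.∸ i))) →
    foldr ℚ._+_ 0ℚ (applyUpTo F (suc k)) ≡ ι ((f K.* g) k)
  convolution zero    f F eq = ≡.trans (ℚ.+-identityʳ _) (eq 0)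
  convolution (suc k) f F eq = ≡.trans
    (≡.cong₂ ℚ._+_ (eq 0) (convolution k (λ i → f (suc i)) (λ i → F (suc i)) (λ i → eq (suc i))))
    (≡.sym (ι-+ (f 0 ℤ.* g (suc k)) (((λ i → f (suc i)) K.* g) k)))

κ-reduces : ∀ z → κ z reducesTo ℤ[[t]].C z
κ-reduces z = coefficients λ { zero → ≡.refl ; (suc _) → ≡.refl }

t-reduces : tP reducesTo ℤ[[t]].X
t-reduces = coefficients λ { zero → ≡.refl ; (suc zero) → ≡.refl ; (suc (suc _)) → ≡.refl }

1-reduces : oneP reducesTo ℤ[[t]].C (+ 1)
1-reduces = coefficients λ { zero → ≡.refl ; (suc _) → ≡.refl }

module Rℤ = Recurrence K._+_ K._-_ K._*_ ℤ[[t]].C ℤ[[t]].X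

^-reduces : ∀ {p f} → p reducesTo f → ∀ m → p ^P m reducesTo f Rℤ.^ m
^-reduces P zero    = 1-reduces
^-reduces P (suc m) = ⊗-reduces P (^-reduces P m)

private
  infixl 6 _+ʳ_ _-ʳ_
  infixl 7 _*ʳ_
  _+ʳ_ = ⊕-reduces
  _-ʳ_ = ⊖-reduces
  _*ʳ_ = ⊗-reduces
  tʳ = t-reduces
  κʳ = κ-reduces
  t^_ : ∀ m → tP ^P m reducesTo ℤ[[t]].X Rℤ.^ m
  t^ m = ^-reduces t-reduces m

A-reduces : ∀ n → A n reducesTo Rℤ.α (ℤ[[t]].C (+ 16 ℤ.* (n ℤ.* n ℤ.+ n)))
A-reduces n = κʳ _ *ʳ
  (κʳ _ *ʳ (t^ 4 -ʳ κʳ _ *ʳ t^ 3 -ʳ κʳ _ *ʳ t^ 2 +ʳ κʳ _ *ʳ tʳ -ʳ 1-reduces)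
  +ʳ (κʳ _ *ʳ t^ 4 -ʳ κʳ _ *ʳ t^ 3 -ʳ κʳ _ *ʳ t^ 2 +ʳ κʳ _ *ʳ tʳ -ʳ κʳ _))

B-reduces : ∀ n → B n reducesTo Rℤ.β (ℤ[[t]].C (+ 8 ℤ.* (n ℤ.* n)))
B-reduces n = κʳ _ *ʳ tʳ *ʳ ^-reduces (tʳ -ʳ 1-reduces) 3 *ʳ (tʳ +ʳ 1-reduces) *ʳ
  (κʳ _ *ʳ (t^ 2 +ʳ κʳ _ *ʳ tʳ -ʳ 1-reduces) -ʳ κʳ _ *ʳ t^ 2 -ʳ κʳ _ *ʳ tʳ +ʳ κʳ _)

C-reduces : ∀ n → Cₙ n reducesTo
  Rℤ.γ K.* ℤ[[t]].C ((+ 2 ℤ.* n ℤ.+ + 1) ℤ.* (+ 2 ℤ.* n ℤ.- + 3))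
C-reduces n = κʳ _ *ʳ t^ 2 *ʳ ^-reduces (tʳ -ʳ 1-reduces) 6
  *ʳ ^-reduces (tʳ +ʳ 1-reduces) 2 *ʳ κʳ _

-- Central binomial coefficients.

central : ℕ → ℕ
central n = (2 * n) C n

central-! : ∀ n → central n * (n ! * n !) ≡ (2 * n) !
central-! n = begin
  central n * (n ! * n !)              ≡⟨ ≡.cong (λ m → central n * (n ! * m !)) 2n∸n≡n ⟨
  central n * (n ! * (2 * n ℕ.∸ n) !)  ≡⟨ ≡.cong (_* (n ! * (2 * n ℕ.∸ n) !)) (nCk≡n!/k![n-k]! n≤2n) ⟩
  ((2 * n) ! ℕ./ (n ! * (2 * n ℕ.∸ n) !)) * (n ! * (2 * n ℕ.∸ n) !)
    ≡⟨ ℕ.m/n*n≡m (k![n∸k]!∣n! n≤2n) ⟩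
  (2 * n) !  ∎
  where
  open ≡.≡-Reasoning
  instance _ = n ℕ.!* (2 * n ℕ.∸ n) !≢0
  n≤2n = ℕ.m≤m+n n (n ℕ.+ 0)
  2n∸n≡n : 2 * n ℕ.∸ n ≡ n
  2n∸n≡n = ≡.trans (ℕ.m+n∸m≡n n (n ℕ.+ 0)) (ℕ.+-identityʳ n)

-- Multiplied by (n+1)(n!)², both sides become (2n+2)!.
central-suc : ∀ n → suc n * central (suc n) ≡ 2 * (2 * n ℕ.+ 1) * central n
central-suc n = ℕ.*-cancelʳ-≡ _ _ (suc n * (n ! * n !)) (begin
  suc n * central (suc n) * (suc n * (n ! * n !))
    ≡⟨ solve 3 (λ m c f → m :* c :* (m :* (f :* f)) := c :* (m :* f :* (m :* f)))
         ≡.refl (suc n) (central (suc n)) (n !) ⟩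
  central (suc n) * (suc n ! * suc n !)  ≡⟨ central-! (suc n) ⟩
  (2 * suc n) !                          ≡⟨ ≡.cong _! (ℕ.*-suc 2 n) ⟩
  suc (suc (2 * n)) * (suc (2 * n) * (2 * n) !)
    ≡⟨ ≡.cong (λ m → suc (suc (2 * n)) * (suc (2 * n) * m)) (central-! n) ⟨
  suc (suc (2 * n)) * (suc (2 * n) * (central n * (n ! * n !)))
    ≡⟨ solve 3 (λ n c f →
         (con 2 :+ con 2 :* n) :* ((con 1 :+ con 2 :* n) :* (c :* (f :* f)))
         := con 2 :* (con 2 :* n :+ con 1) :* c :* ((con 1 :+ n) :* (f :* f)))
         ≡.refl n (central n) (n !) ⟩
  2 * (2 * n ℕ.+ 1) * central n * (suc n * (n ! * n !))  ∎)
  where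
  open ≡.≡-Reasoning
  open ℕ.+-*-Solver
  instance _ = ℕ.m*n≢0 (suc n) (n ! * n !) {{_}} {{n ℕ.!* n !≢0}}

-- Extension by zero to negative indices preserves the ratio relations and agrees with u_n = 0 for n
-- < 0.
c c¹ c² : ℕ → ℤ
c n = + central n
c¹ zero    = + 0
c¹ (suc n) = c n
c² zero    = + 0
c² (suc n) = c¹ n

c-suc : ∀ n → + suc n ℤ.* c (suc n) ≡ + 2 ℤ.* (+ 2 ℤ.* + n ℤ.+ + 1) ℤ.* c n
c-suc n = ≡.trans (≡.sym (ℤ.pos-* (suc n) (central (suc n)))) (≡.trans (≡.cong +_ (central-suc n))
  (≡.trans (ℤ.pos-* (2 * (2 * n ℕ.+ 1)) (central n)) (≡.cong (ℤ._* c n)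
    (≡.trans (ℤ.pos-* 2 (2 * n ℕ.+ 1)) (≡.cong (λ z → + 2 ℤ.* (z ℤ.+ + 1)) (ℤ.pos-* 2 n))))))

shift-index : ∀ n i j → + 2 ℤ.* (+ 2 ℤ.* (i ℤ.+ + n) ℤ.+ j) ≡ + 2 ℤ.* (+ 2 ℤ.* + n ℤ.+ (+ 2 ℤ.* i ℤ.+ j))
shift-index n = solve 3 (λ n i j → con (+ 2) :* (con (+ 2) :* (i :+ n) :+ j)
  := con (+ 2) :* (con (+ 2) :* n :+ (con (+ 2) :* i :+ j))) ≡.refl (+ n)
  where
  open ℤ.+-*-Solver

c⁺-relation : ∀ n → (+ n ℤ.+ + 1) ℤ.* c (suc n) ≡ + 2 ℤ.* (+ 2 ℤ.* + n ℤ.+ + 1) ℤ.* c n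
c⁺-relation n = ≡.trans (≡.cong (ℤ._* c (suc n)) (ℤ.+-comm (+ n) (+ 1))) (c-suc n)

c-relation : ∀ n → (+ n ℤ.+ + 0) ℤ.* c n ≡ + 2 ℤ.* (+ 2 ℤ.* + n ℤ.+ ℤ.- + 1) ℤ.* c¹ n
c-relation zero    = ≡.refl
c-relation (suc n) = ≡.trans (≡.cong (ℤ._* c (suc n)) (ℤ.+-identityʳ (+ suc n)))
  (≡.trans (c-suc n) (≡.cong (ℤ._* c n) (≡.sym (shift-index n (+ 1) (ℤ.- + 1)))))

c¹-relation : ∀ n → (+ n ℤ.+ ℤ.- + 1) ℤ.* c¹ n ≡ + 2 ℤ.* (+ 2 ℤ.* + n ℤ.+ ℤ.- + 3) ℤ.* c² n
c¹-relation zero          = ≡.refl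
c¹-relation (suc zero)    = ≡.refl
c¹-relation (suc (suc n)) = ≡.trans (c-suc n)
  (≡.cong (ℤ._* c n) (≡.sym (shift-index n (+ 2) (ℤ.- + 3))))

-- Induction along the recurrence.

module Divisibility (solution : Solution ℤ[[t]].seriesRing ℤ[[t]].constants ℤ[[t]].X) where
  private
    module V = Solution solution

  Divisible : ℕ → Poly × Poly × Poly → Set
  Divisible n (a₀ , a₁ , a₂) =
      a₀ reducesTo ℤ[[t]].C (c n) K.* V.v n
    × a₁ reducesTo ℤ[[t]].C (c¹ n) K.* V.v¹ n
    × a₂ reducesTo ℤ[[t]].C (c² n) K.* V.v² n

  reduces-≈ : ∀ {p f g} → p reducesTo f → f K.≈ g → p reducesTo g
  reduces-≈ P f≈g = coefficients λ k → ≡.trans (coefficient P k) (≡.cong ι (f≈g k))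

  zero-reduces : ∀ f → zeroP reducesTo ℤ[[t]].C (+ 0) K.* f
  zero-reduces f = coefficients λ k → ≡.cong ι (≡.sym (ℤ[[t]].C-⊠ (+ 0) f k))

  -- `u-recurrence` presents the numerator as (n+1)² times an integral series, so the division made
  -- by `step` is exact.
  step-reduces : ∀ n {p₀ p₁ p₂} → Divisible n (p₀ , p₁ , p₂) →
    step n p₀ p₁ p₂ reducesTo ℤ[[t]].C (c (suc n)) K.* V.v (suc n)
  step-reduces n (P₀ , P₁ , P₂) = coefficients λ k → ≡.trans
    (≡.cong (((+ 1) ℚ./ (suc n * suc n)) ℚ.*_) (≡.trans
      (coefficient (A-reduces (+ n) *ʳ P₀ +ʳ B-reduces (+ n) *ʳ P₁ -ʳ C-reduces (+ n) *ʳ P₂) k)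
      (≡.cong ι (≡.trans
        (V.u-recurrence n (c⁺-relation n) (c-relation n) (c¹-relation n) k)
        (ℤ[[t]].C-⊠ (+ (suc n * suc n)) (ℤ[[t]].C (c (suc n)) K.* V.v (suc n)) k)))))
    (1/n*ι (suc n * suc n) ((ℤ[[t]].C (c (suc n)) K.* V.v (suc n)) k))

  divisible : ∀ n → Divisible n (U n)
  divisible zero =
    reduces-≈ 1-reduces (λ k → ≡.sym (≡.trans (K.*-identityˡ (V.v 0) k) (V.v-zero k))) ,
    zero-reduces (V.v¹ 0) , zero-reduces (V.v² 0)
  divisible (suc n) =
    step-reduces n (divisible n) ,
    reduces-≈ (proj₁ (divisible n))
      (ℤ[[t]].⊠-cong {ℤ[[t]].C (c n)} (λ _ → ≡.refl) (λ k → ≡.sym (V.v¹-suc n k))) ,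
    reduces-≈ (proj₁ (proj₂ (divisible n)))
      (ℤ[[t]].⊠-cong {ℤ[[t]].C (c¹ n)} (λ _ → ≡.refl) (λ k → ≡.sym (V.v²-suc n k)))

  u-divisible : ∀ n k → ∃[ z ] u n k ≡ ι (+ ((2 * n) C n) ℤ.* z)
  u-divisible n k = V.v n k ,
    ≡.trans (coefficient (proj₁ (divisible n)) k) (≡.cong ι (ℤ[[t]].C-⊠ (c n) (V.v n) k))

theorem2 : (n k : ℕ) → ∃[ z ] u n k ≡ ι (+ ((2 * n) C n) ℤ.* z)
theorem2 = Divisibility.u-divisible (Coefficients.solution ℤ[[t]].seriesRing ℤ[[t]].constants
  (ℤ[[t]].torsionFree ℤ-torsionFree) ℤ[[t]].X)
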